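{- For every procedure $f\in\mathcal F$, let $T(f)=\{w\mid f\downarrow w\}\cup\{w\mid f\uparrow w\}$. There is a derivable judgement $\vdash_{\mathfrak A} f\ \&\ (\mathcal U_f,\mathcal V_f)$ (empty environment, $\mathcal U_f\in\mathcal M_*$, $\mathcal V_f\in\mathcal M_{\le\omega}$) such that $T(f)\subseteq L(\mathfrak A)$ if and only if $\gamma_*(\mathcal U_f)\cup\gamma_{\le\omega}(\mathcal V_f)\subseteq L(\mathfrak A)$.
   Context: Language and semantics. Fix a finite alphabet $\Sigma$ of events; $\Sigma^{\le\omega}=\Sigma^*\cup\Sigma^\omega$; $w\cdot u=wu$ if $w$ is finite and $w\cdot u=w$ if $w$ is infinite, extended pointwise to languages; for $A\subseteq\Sigma^*$, $A^*$ is the Kleene star and $A^\omega$ the set of words $w_0w_1w_2\cdots$ with $w_i\in A$; $CD^\omega$ means $C\cdot D^\omega$. Expressions: $e::=o(a)\mid f\mid e_1;e_2\mid e_1?e_2$ ($a\in\Sigma$, $f$ a procedure name). A fixed program consists of a finite set $\mathcal F$ of procedure names and a defining expression $e_f$ for each $f\in\mathcal F$ using only names from $\mathcal F$. Let $\checkmark\notin\Sigma$; $e\Downarrow w$ and $e\Uparrow w$ ($w\in(\Sigma\uplus\{\checkmark\})^*$) are the least relations with: $o(a)\Downarrow a$; $o(a)\Uparrow a$; $e\Uparrow\epsilon$; $e_f\Downarrow w\Rightarrow f\Downarrow w$; $e_f\Uparrow w\Rightarrow f\Uparrow\checkmark w$; $e_1\Downarrow w,e_2\Downarrow u\Rightarrow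 e_1;e_2\Downarrow wu$; $e_1\Downarrow w,e_2\Uparrow u\Rightarrow e_1;e_2\Uparrow wu$; $e_1\Uparrow w\Rightarrow e_1;e_2\Uparrow w$; $e_i\Downarrow w\Rightarrow e_1?e_2\Downarrow w$ and $e_i\Uparrow w\Rightarrow e_1?e_2\Uparrow w$ ($i=1,2$). $\theta$ deletes all $\checkmark$. $e\downarrow w$ iff $w=\theta(w')$ for a finite $w'$ with $e\Downarrow w'$; $e\uparrow w$ iff $w=\theta(w')$ for an infinite $w'\in(\Sigma\uplus\{\checkmark\})^\omega$ all of whose finite prefixes $u$ satisfy $e\Uparrow u$. Abstraction. Fix an extended Büchi automaton $\mathfrak A=(Q,\Sigma,\delta,q_0,F)$; its language $L(\mathfrak A)\subseteq\Sigma^{\le\omega}$ consists of all finite words along which some path from $q_0$ reaches a final state and all infinite words with a run from $q_0$ visiting $F$ infinitely often. For $w\in\Sigma^*$, $p\overset{w}{\leadsto}q$ means $q$ is reachable from $p$ reading $w$; $p\overset{w}{\leadsto}_Fq$ means $w=uv$, $p\overset{u}{\leadsto}q''\overset{v}{\leadsto}q$ for some $q''\in F$. For $w,u\in\Sigma^+$, $w\sim u$ iff for all $p,q$ both relations agree on $w$ and $u$. $\mathcal Q=\Sigma^+/{\sim}\uplus\{\{\epsilon\}\}$, a monoid under class concatenation. $\mathcal C=\{(C,D)\in\mathcal Q^2\mid CD=C,DD=D\}$; $\mathfrak f(V)=\{(C,D)\in\mathcal C\mid CD^\omega\cap V\ne\emptyset\}$; $\mathfrak g(\mathcal V)=\bigcup_{(C,D)\in\mathcal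 V}CD^\omega$; $\mathfrak c(\mathcal V)=\bigcup_{n\ge1}(\mathfrak f\circ\mathfrak g)^n(\mathcal V)$; $\mathcal M_{\le\omega}=\{\mathfrak c(\mathfrak f(V))\mid V\subseteq\Sigma^{\le\omega}\}$; $\mathcal M_*=\mathcal P(\mathcal Q)$. $\alpha_*(U)=\{C\in\mathcal Q\mid C\cap U\ne\emptyset\}$, $\alpha_{\le\omega}(V)=\mathfrak c(\mathfrak f(V))$, $\gamma_*(\mathcal U)=\bigcup_{C\in\mathcal U}C$, $\gamma_{\le\omega}=\mathfrak g$. Abstract operations: $\mathcal U\cdot\mathcal U'=\{CC'\mid C\in\mathcal U,C'\in\mathcal U'\}$; $\mathcal U\cdot\mathcal V=\{(AC,D)\mid A\in\mathcal U,(C,D)\in\mathcal V\}$ for $\mathcal V\in\mathcal M_{\le\omega}$; unions are set unions; $\mathcal U^*:=\alpha_*(\gamma_*(\mathcal U)^*)$; $\mathcal U^\omega:=\alpha_{\le\omega}(\gamma_*(\mathcal U)^\omega)$. Büchi type system. Let $\mathfrak X$ be a set of variables. An expression $\mathcal V(\mathfrak X)$ is a formal expression $\bigcup_{Y\in\mathfrak X}(\mathcal A_Y\cdot Y)\cup\mathcal B$ with $\mathcal A_Y\in\mathcal M_*$, $\mathcal B\in\mathcal M_{\le\omega}$; $\mathcal V(\mathfrak X-X)$ denotes one with $\mathcal A_X=\emptyset$; a variable $X$ denotes the expression with $\mathcal A_X=\{\{\epsilon\}\}$, other coefficients empty; $\mathcal B$ denotes the expression with all $\mathcal A_Y=\emptyset$.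 $\mathcal A\cdot\mathcal V(\mathfrak X)=\bigcup_Y((\mathcal A\cdot\mathcal A_Y)\cdot Y)\cup(\mathcal A\cdot\mathcal B)$; $\cup$ componentwise. An environment $\Delta$ is a finite set of bindings $f\ \&\ (\mathcal U,X)$ ($f\in\mathcal F$, $\mathcal U\in\mathcal M_*$, $X\in\mathfrak X$), distinct bindings with distinct variables. Rules: (i) $\Delta\vdash_{\mathfrak A}o(a)\ \&\ (\alpha_*(\{a\}),\emptyset)$; (ii) from $\Delta\vdash_{\mathfrak A}e_1\ \&\ (\mathcal U_1,\mathcal V_1(\mathfrak X))$ and $\Delta\vdash_{\mathfrak A}e_2\ \&\ (\mathcal U_2,\mathcal V_2(\mathfrak X))$ infer $\Delta\vdash_{\mathfrak A}e_1;e_2\ \&\ (\mathcal U_1\cdot\mathcal U_2,\mathcal V_1(\mathfrak X)\cup\mathcal U_1\cdot\mathcal V_2(\mathfrak X))$; (iii) from the same premises infer $\Delta\vdash_{\mathfrak A}e_1?e_2\ \&\ (\mathcal U_1\cup\mathcal U_2,\mathcal V_1(\mathfrak X)\cup\mathcal V_2(\mathfrak X))$; (iv) $\Delta,f\ \&\ (\mathcal U,X)\vdash_{\mathfrak A}f\ \&\ (\mathcal U,X)$; (v) from $\Delta,f\ \&\ (\mathcal U,X)\vdash_{\mathfrak A}e_f\ \&\ (\mathcal U,\mathcal A\cdot X\cup\mathcal V(\mathfrak X-X))$ infer $\Delta\vdash_{\mathfrak A}f\ \&\ (\mathcal U,\mathcal A^*\cdot\mathcal V(\mathfrak X-X)\cup\mathcal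 A^\omega)$.
   Formalization: The rule for returning calls is corrected to: e_f ⇓ w implies f ⇓ ✓w (as printed, e_f = a;b, e_g = f;g, L = ∅ refutes the claim, since g then has no infinite trace); and the set of variables is assumed to have at least as many elements as there are procedures. -}

module Defs where

open import Algebra.Bundles using (Monoid)
open import Data.Empty using (⊥)
open import Data.Fin.Base using (Fin)
open import Data.Fin.Subset using (Subset) renaming (_∈_ to _∈ˢ_)
open import Data.List.Base using (List; []; _∷_; _++_; [_]; length; concat; applyUpTo; catMaybes)
open import Data.List.Fresh using (List#; cons; _#_)
open import Data.List.Fresh.Relation.Unary.Any using () renaming (Any to Any#)
open import Data.List.Properties using (++-assoc; ++-identityʳ)
open import Data.List.Relation.Binary.Prefix.Heterogeneous using (Prefix)
open import Data.List.Relation.Unary.All using (All)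
open import Data.Maybe.Base using (Maybe; just; nothing)
open import Data.Nat.Base using (ℕ; zero; suc; _≤_)
open import Data.Nat.GeneralisedArithmetic using (fold)
open import Data.Product.Base using (Σ; ∃; ∃₂; _×_; _,_; proj₁; proj₂)
open import Data.Sum.Base using (_⊎_; inj₁; inj₂)
open import Function.Base using (_∘_)
open import Function.Bundles using (_⇔_; mk⇔; Equivalence)
open import Function.Construct.Composition using (_⇔-∘_)
open import Function.Construct.Identity using (⇔-id)
open import Function.Construct.Symmetry using (⇔-sym)
open import Level using (0ℓ) renaming (suc to lsuc)
open import Relation.Binary.Definitions using (_Respects_)
open import Relation.Binary.PropositionalEquality using (_≡_; _≢_; refl; sym; cong; _≗_)
open import Relation.Unary using (Pred; ∅; _∪_; _≐_; _≬_; ｛_｝)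

------------------------------------------------------------------------
-- Finite and infinite words

data Word (A : Set) : Set where
  fin : List A → Word A
  inf : (ℕ → A) → Word A

module _ {A : Set} where

  infix  4 _≋_ _⊑_
  infixr 5 _·_
  infixr 6 _⊙_
  infix  8 _⋆ _^ω

  -- Equality of words; infinite words are compared letter by letter.
  data _≋_ : Word A → Word A → Set where
    fin : ∀ {u v} → u ≡ v → fin u ≋ fin v
    inf : ∀ {x y} → x ≗ y → inf x ≋ inf y

  prepend : List A → (ℕ → A) → ℕ → A
  prepend []      x n       = x n
  prepend (a ∷ w) x zero    = a
  prepend (a ∷ w) x (suc n) = prepend w x n

  _·_ : List A → Word A → Word A
  w · fin u = fin (w ++ u)
  w · inf x = inf (prepend w x)

  _⊑_ : List A → Word A → Set
  u ⊑ fin w = Prefix _≡_ u w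
  u ⊑ inf x = u ≡ applyUpTo x (length u)

  -- w is the limit (supremum in the prefix order) of the chain s.  It is
  -- finite exactly when the chain is eventually constant.
  record Limit (s : ℕ → List A) (w : Word A) : Set where
    field
      upper : ∀ n → s n ⊑ w
      least : ∀ u → u ⊑ w → ∃ λ n → Prefix _≡_ u (s n)

  -- A language of finite words as a language of finite or infinite words.
  finitary : Pred (List A) 0ℓ → Pred (Word A) 0ℓ
  finitary U (fin w) = U w
  finitary U (inf _) = ⊥

  _⊙_ : Pred (List A) 0ℓ → Pred (Word A) 0ℓ → Pred (Word A) 0ℓ
  (U ⊙ V) w = ∃₂ λ u v → U u × V v × (u · v) ≋ w

  _⋆ : Pred (List A) 0ℓ → Pred (List A) 0ℓ
  (U ⋆) w = ∃ λ ws → All U ws × concat ws ≡ w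

  -- The product w₀w₁w₂⋯ is a finite word when almost all wᵢ are empty.
  _^ω : Pred (List A) 0ℓ → Pred (Word A) 0ℓ
  (U ^ω) w = ∃ λ (ws : ℕ → List A) →
    (∀ i → U (ws i)) × Limit (λ n → concat (applyUpTo ws n)) w

------------------------------------------------------------------------
-- Programs over the alphabet Fin s with procedure names Fin m

infixl 6 _⨾_
infixl 5 _⁇_

data Expr (s m : ℕ) : Set where
  o    : Fin s → Expr s m
  call : Fin m → Expr s m
  _⨾_  : Expr s m → Expr s m → Expr s m
  _⁇_  : Expr s m → Expr s m → Expr s m

Program : ℕ → ℕ → Set
Program s m = Fin m → Expr s m

module Semantics {s m : ℕ} (P : Program s m) where

  infix 4 _⇓_ _⇑_ _↓_ _↑_

  Event : Set
  Event = Maybe (Fin s)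

  pattern ✓ = nothing

  -- Every call emits a ✓, also in the runs that return.  This is what
  -- makes e ⇑_ hold of all prefixes of the words with e ⇓_ or e ⇑_, as the
  -- definition of _↑_ presupposes.  If returning calls emitted no ✓, then
  -- with f = a ; b and g = f ; g neither f nor f ; g would satisfy ⇑ a, and
  -- g would have no infinite trace instead of (ab)^ω.
  data _⇓_ : Expr s m → List Event → Set where
    ⇓-o    : ∀ {a} → o a ⇓ [ just a ]
    ⇓-call : ∀ {f w} → P f ⇓ w → call f ⇓ ✓ ∷ w
    ⇓-⨾    : ∀ {e₁ e₂ w u} → e₁ ⇓ w → e₂ ⇓ u → e₁ ⨾ e₂ ⇓ w ++ u
    ⇓-⁇₁   : ∀ {e₁ e₂ w} → e₁ ⇓ w → e₁ ⁇ e₂ ⇓ w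
    ⇓-⁇₂   : ∀ {e₁ e₂ w} → e₂ ⇓ w → e₁ ⁇ e₂ ⇓ w

  data _⇑_ : Expr s m → List Event → Set where
    ⇑-o    : ∀ {a} → o a ⇑ [ just a ]
    ⇑-ε    : ∀ {e} → e ⇑ []
    ⇑-call : ∀ {f w} → P f ⇑ w → call f ⇑ ✓ ∷ w
    ⇑-⨾₂   : ∀ {e₁ e₂ w u} → e₁ ⇓ w → e₂ ⇑ u → e₁ ⨾ e₂ ⇑ w ++ u
    ⇑-⨾₁   : ∀ {e₁ e₂ w} → e₁ ⇑ w → e₁ ⨾ e₂ ⇑ w
    ⇑-⁇₁   : ∀ {e₁ e₂ w} → e₁ ⇑ w → e₁ ⁇ e₂ ⇑ w
    ⇑-⁇₂   : ∀ {e₁ e₂ w} → e₂ ⇑ w → e₁ ⁇ e₂ ⇑ w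

  θ : List Event → List (Fin s)
  θ = catMaybes

  _↓_ : Expr s m → Pred (List (Fin s)) 0ℓ
  e ↓ w = ∃ λ w′ → w ≡ θ w′ × e ⇓ w′

  -- θ of an infinite word x is the limit of θ on its finite prefixes.
  _↑_ : Expr s m → Pred (Word (Fin s)) 0ℓ
  e ↑ w = ∃ λ (x : ℕ → Event) →
    Limit (λ n → θ (applyUpTo x n)) w × (∀ n → e ⇑ applyUpTo x n)

  T : Fin m → Pred (Word (Fin s)) 0ℓ
  T f = finitary (call f ↓_) ∪ (call f ↑_)

------------------------------------------------------------------------
-- Extended Büchi automata

record Automaton (s : ℕ) : Set where
  field
    {states} : ℕ
    δ        : Fin states → Fin s → Subset states
    q₀       : Fin states
    F        : Subset states

module Abstraction {s : ℕ} (𝔄 : Automaton s) where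

  open Automaton 𝔄

  private
    State : Set
    State = Fin states

  infix 4 _⟿[_]_ _⟿F[_]_ _~_ _≈_

  _⟿[_]_ : State → List (Fin s) → State → Set
  p ⟿[ []    ] q = p ≡ q
  p ⟿[ a ∷ w ] q = ∃ λ r → r ∈ˢ δ p a × r ⟿[ w ] q

  _⟿F[_]_ : State → List (Fin s) → State → Set
  p ⟿F[ w ] q = ∃₂ λ u v → ∃ λ r →
    w ≡ u ++ v × r ∈ˢ F × p ⟿[ u ] r × r ⟿[ v ] q

  L : Pred (Word (Fin s)) 0ℓ
  L (fin w) = ∃ λ q → q ∈ˢ F × q₀ ⟿[ w ] q
  L (inf x) = ∃ λ (ρ : ℕ → State) →
    ρ 0 ≡ q₀ × (∀ i → ρ (suc i) ∈ˢ δ (ρ i) (x i)) × (∀ n → ∃ λ k → n ≤ k × ρ k ∈ˢ F)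

  _~_ : List (Fin s) → List (Fin s) → Set
  w ~ u = ∀ p q → (p ⟿[ w ] q ⇔ p ⟿[ u ] q) × (p ⟿F[ w ] q ⇔ p ⟿F[ u ] q)

  data _≈_ : List (Fin s) → List (Fin s) → Set where
    ε≈ε : [] ≈ []
    ~⇒≈ : ∀ {a w b u} → a ∷ w ~ b ∷ u → a ∷ w ≈ b ∷ u

  private
    split : ∀ w {u p q} → p ⟿[ w ++ u ] q → ∃ λ r → p ⟿[ w ] r × r ⟿[ u ] q
    split []      π              = _ , refl , π
    split (a ∷ w) (r , r∈δ , π) with split w π
    ... | r′ , π₁ , π₂ = r′ , (r , r∈δ , π₁) , π₂

    join : ∀ w {u p r q} → p ⟿[ w ] r → r ⟿[ u ] q → p ⟿[ w ++ u ] q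
    join []      refl            π = π
    join (a ∷ w) (r , r∈δ , π₁) π₂ = r , r∈δ , join w π₁ π₂

    splitF : ∀ w {u p q} → p ⟿F[ w ++ u ] q →
      ∃ λ r → (p ⟿F[ w ] r × r ⟿[ u ] q) ⊎ (p ⟿[ w ] r × r ⟿F[ u ] q)
    splitF []      π = _ , inj₂ (refl , π)
    splitF (a ∷ w) ([] , _ , r , refl , r∈F , refl , π) with split (a ∷ w) π
    ... | r′ , π₁ , π₂ = r′ , inj₁ (([] , a ∷ w , r , refl , r∈F , refl , π₁) , π₂)
    splitF (a ∷ w) (_ ∷ x , y , r , eq , r∈F , (t , t∈δ , π₁) , π₂)
      with refl ← cong (λ { [] → a ; (b ∷ _) → b }) eq
      with splitF w (x , y , r , cong (λ { [] → [] ; (_ ∷ z) → z }) eq , r∈F , π₁ , π₂)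
    ... | r′ , inj₁ ((x′ , y′ , r″ , refl , r″∈F , σ₁ , σ₂) , σ₃) =
          r′ , inj₁ ((a ∷ x′ , y′ , r″ , refl , r″∈F , (t , t∈δ , σ₁) , σ₂) , σ₃)
    ... | r′ , inj₂ (σ₁ , σ₂) = r′ , inj₂ ((t , t∈δ , σ₁) , σ₂)

    joinF₁ : ∀ {w u p r q} → p ⟿F[ w ] r → r ⟿[ u ] q → p ⟿F[ w ++ u ] q
    joinF₁ {u = u} (x , y , r , refl , r∈F , π₁ , π₂) π₃ =
      x , y ++ u , r , ++-assoc x y u , r∈F , π₁ , join y π₂ π₃

    joinF₂ : ∀ w {u p r q} → p ⟿[ w ] r → r ⟿F[ u ] q → p ⟿F[ w ++ u ] q
    joinF₂ w π₁ (x , y , r , refl , r∈F , π₂ , π₃) =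
      w ++ x , y , r , sym (++-assoc w x y) , r∈F , join w π₁ π₂ , π₃

    ~-refl : ∀ {w} → w ~ w
    ~-refl p q = ⇔-id _ , ⇔-id _

    ~-sym : ∀ {w u} → w ~ u → u ~ w
    ~-sym e p q = ⇔-sym (proj₁ (e p q)) , ⇔-sym (proj₂ (e p q))

    ~-trans : ∀ {w u v} → w ~ u → u ~ v → w ~ v
    ~-trans e e′ p q = proj₁ (e′ p q) ⇔-∘ proj₁ (e p q) , proj₂ (e′ p q) ⇔-∘ proj₂ (e p q)

    ++-mono : ∀ {w w′ u u′} → w ~ w′ → u ~ u′ → ∀ {p q} →
      (p ⟿[ w ++ u ] q → p ⟿[ w′ ++ u′ ] q) × (p ⟿F[ w ++ u ] q → p ⟿F[ w′ ++ u′ ] q)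
    ++-mono {w} {w′} e e′ = ⟿-mono , ⟿F-mono
      where
      open Equivalence using (to)
      ⟿-mono : _
      ⟿-mono π with split w π
      ... | r , π₁ , π₂ = join w′ (to (proj₁ (e _ _)) π₁) (to (proj₁ (e′ _ _)) π₂)
      ⟿F-mono : _
      ⟿F-mono π with splitF w π
      ... | r , inj₁ (π₁ , π₂) = joinF₁ (to (proj₂ (e _ _)) π₁) (to (proj₁ (e′ _ _)) π₂)
      ... | r , inj₂ (π₁ , π₂) = joinF₂ w′ (to (proj₁ (e _ _)) π₁) (to (proj₂ (e′ _ _)) π₂)

    ~-cong : ∀ {w w′ u u′} → w ~ w′ → u ~ u′ → w ++ u ~ w′ ++ u′
    ~-cong e e′ p q =
      mk⇔ (proj₁ (++-mono e e′)) (proj₁ (++-mono (~-sym e) (~-sym e′))) ,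
      mk⇔ (proj₂ (++-mono e e′)) (proj₂ (++-mono (~-sym e) (~-sym e′)))

    ≈⇒~ : ∀ {w u} → w ≈ u → w ~ u
    ≈⇒~ ε≈ε     = ~-refl
    ≈⇒~ (~⇒≈ e) = e

    ≈-refl : ∀ {w} → w ≈ w
    ≈-refl {[]}    = ε≈ε
    ≈-refl {_ ∷ _} = ~⇒≈ ~-refl

    ≈-sym : ∀ {w u} → w ≈ u → u ≈ w
    ≈-sym ε≈ε     = ε≈ε
    ≈-sym (~⇒≈ e) = ~⇒≈ (~-sym e)

    ≈-trans : ∀ {w u v} → w ≈ u → u ≈ v → w ≈ v
    ≈-trans ε≈ε     ε≈ε      = ε≈ε
    ≈-trans (~⇒≈ e) (~⇒≈ e′) = ~⇒≈ (~-trans e e′)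

    ≈-cong : ∀ {w w′ u u′} → w ≈ w′ → u ≈ u′ → w ++ u ≈ w′ ++ u′
    ≈-cong ε≈ε     e′ = e′
    ≈-cong (~⇒≈ e) e′ = ~⇒≈ (~-cong e (≈⇒~ e′))

    ≡⇒≈ : ∀ {w u} → w ≡ u → w ≈ u
    ≡⇒≈ refl = ≈-refl

  -- The quotient 𝒬 as a setoid: a word stands for its class, so the class of
  -- w as a language is the predicate w ≈_.
  𝒬 : Monoid 0ℓ 0ℓ
  𝒬 = record
    { Carrier  = List (Fin s)
    ; _≈_      = _≈_
    ; _∙_      = _++_
    ; ε        = []
    ; isMonoid = record
      { isSemigroup = record
        { isMagma = record
          { isEquivalence = record { refl = ≈-refl ; sym = ≈-sym ; trans = ≈-trans }
          ; ∙-cong        = ≈-cong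
          }
        ; assoc = λ x y z → ≡⇒≈ (++-assoc x y z)
        }
      ; identity = (λ _ → ≈-refl) , (λ x → ≡⇒≈ (++-identityʳ x))
      }
    }

  open Monoid 𝒬 public using (_∙_; ε) renaming (Carrier to Q)

  _[_]^ω : Q → Q → Pred (Word (Fin s)) 0ℓ
  C [ D ]^ω = (C ≈_) ⊙ ((D ≈_) ^ω)

  𝒞 : Pred (Q × Q) 0ℓ
  𝒞 (C , D) = C ∙ D ≈ C × D ∙ D ≈ D

  𝔣 : Pred (Word (Fin s)) 0ℓ → Pred (Q × Q) 0ℓ
  𝔣 V (C , D) = 𝒞 (C , D) × (C [ D ]^ω ≬ V)

  𝔤 : Pred (Q × Q) 0ℓ → Pred (Word (Fin s)) 0ℓ
  𝔤 𝒱 w = ∃₂ λ C D → 𝒱 (C , D) × (C [ D ]^ω) w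

  𝔠 : Pred (Q × Q) 0ℓ → Pred (Q × Q) 0ℓ
  𝔠 𝒱 CD = ∃ λ n → 1 ≤ n × fold 𝒱 (𝔣 ∘ 𝔤) n CD

  -- Sets of classes are predicates that respect ≈.  Equality of sets is
  -- extensional (_≐_), also in membership of the image 𝓜ω.
  𝓜* : Set₁
  𝓜* = Σ (Pred Q 0ℓ) (_Respects _≈_)

  𝓜ω : Set₁
  𝓜ω = Σ (Pred (Q × Q) 0ℓ) λ 𝒱 → ∃ λ V → 𝒱 ≐ 𝔠 (𝔣 V)

  α* : Pred (List (Fin s)) 0ℓ → Pred Q 0ℓ
  α* U C = (C ≈_) ≬ U

  αω : Pred (Word (Fin s)) 0ℓ → Pred (Q × Q) 0ℓ
  αω V = 𝔠 (𝔣 V)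

  γ* : Pred Q 0ℓ → Pred (List (Fin s)) 0ℓ
  γ* 𝒰 w = ∃ λ C → 𝒰 C × C ≈ w

  γω : Pred (Q × Q) 0ℓ → Pred (Word (Fin s)) 0ℓ
  γω = 𝔤

  infixr 7 _∙*_ _∙ω_
  infix  8 _⋆ᵃ _ωᵃ

  _∙*_ : Pred Q 0ℓ → Pred Q 0ℓ → Pred Q 0ℓ
  (𝒰 ∙* 𝒰′) x = ∃₂ λ C C′ → 𝒰 C × 𝒰′ C′ × C ∙ C′ ≈ x

  _∙ω_ : Pred Q 0ℓ → Pred (Q × Q) 0ℓ → Pred (Q × Q) 0ℓ
  (𝒰 ∙ω 𝒱) (x , y) = ∃ λ A → ∃₂ λ C D → 𝒰 A × 𝒱 (C , D) × A ∙ C ≈ x × D ≈ y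

  _⋆ᵃ : Pred Q 0ℓ → Pred Q 0ℓ
  𝒰 ⋆ᵃ = α* (γ* 𝒰 ⋆)

  _ωᵃ : Pred Q 0ℓ → Pred (Q × Q) 0ℓ
  𝒰 ωᵃ = αω (γ* 𝒰 ^ω)

------------------------------------------------------------------------
-- The Büchi type system

module TypeSystem {s m : ℕ} (P : Program s m) (𝔄 : Automaton s) (𝔛 : Set) where

  open Abstraction 𝔄

  -- A formal expression ⋃_Y (𝒜_Y · Y) ∪ ℬ, with coefficients that are
  -- arbitrary families (Formal) or members of 𝓜* and 𝓜ω (Expression).
  record Formal : Set₁ where
    field
      coeff : 𝔛 → Pred Q 0ℓ
      const : Pred (Q × Q) 0ℓ

  record Expression : Set₁ where
    field
      coeff : 𝔛 → 𝓜*
      const : 𝓜ω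

    formal : Formal
    formal = record { coeff = λ Y → proj₁ (coeff Y) ; const = proj₁ const }

  open Expression using (formal)

  infix  4 _≐ᶠ_
  infixr 6 _∪ᶠ_
  infixr 7 _∙ᶠ_

  _≐ᶠ_ : Formal → Formal → Set
  E ≐ᶠ E′ = (∀ Y → Formal.coeff E Y ≐ Formal.coeff E′ Y) × Formal.const E ≐ Formal.const E′

  var : 𝔛 → Formal
  var X = record { coeff = λ Y C → Y ≡ X × C ≈ ε ; const = ∅ }

  constant : Pred (Q × Q) 0ℓ → Formal
  constant ℬ = record { coeff = λ _ → ∅ ; const = ℬ }

  _∙ᶠ_ : Pred Q 0ℓ → Formal → Formal
  𝒜 ∙ᶠ E = record
    { coeff = λ Y → 𝒜 ∙* Formal.coeff E Y ; const = 𝒜 ∙ω Formal.const E }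

  _∪ᶠ_ : Formal → Formal → Formal
  E ∪ᶠ E′ = record
    { coeff = λ Y → Formal.coeff E Y ∪ Formal.coeff E′ Y
    ; const = Formal.const E ∪ Formal.const E′
    }

  record Binding : Set₁ where
    constructor _&_,_
    field
      proc : Fin m
      set  : 𝓜*
      name : 𝔛

  Env : Set₁
  Env = List# Binding (λ b b′ → Binding.name b ≢ Binding.name b′)

  infix 4 _∈_ _⊢_&_,_

  _∈_ : Binding → Env → Set₁
  b ∈ Δ = Any# (b ≡_) Δ

  -- The types in a judgement are members of 𝓜* and expressions over 𝓜* and
  -- 𝓜ω, given up to extensional equality; hence every conclusion states its
  -- type by an equation.
  data _⊢_&_,_ (Δ : Env) : Expr s m → 𝓜* → Expression → Set₁ where

    ⊢o : ∀ {a 𝒰 V} →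
      proj₁ 𝒰 ≐ α* ｛ [ a ] ｝ →
      formal V ≐ᶠ constant ∅ →
      Δ ⊢ o a & 𝒰 , V

    ⊢⨾ : ∀ {e₁ e₂ 𝒰₁ 𝒰₂ V₁ V₂ 𝒰 V} →
      Δ ⊢ e₁ & 𝒰₁ , V₁ →
      Δ ⊢ e₂ & 𝒰₂ , V₂ →
      proj₁ 𝒰 ≐ proj₁ 𝒰₁ ∙* proj₁ 𝒰₂ →
      formal V ≐ᶠ formal V₁ ∪ᶠ proj₁ 𝒰₁ ∙ᶠ formal V₂ →
      Δ ⊢ e₁ ⨾ e₂ & 𝒰 , V

    ⊢⁇ : ∀ {e₁ e₂ 𝒰₁ 𝒰₂ V₁ V₂ 𝒰 V} →
      Δ ⊢ e₁ & 𝒰₁ , V₁ →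
      Δ ⊢ e₂ & 𝒰₂ , V₂ →
      proj₁ 𝒰 ≐ proj₁ 𝒰₁ ∪ proj₁ 𝒰₂ →
      formal V ≐ᶠ formal V₁ ∪ᶠ formal V₂ →
      Δ ⊢ e₁ ⁇ e₂ & 𝒰 , V

    ⊢var : ∀ {f 𝒰₀ X 𝒰 V} →
      (f & 𝒰₀ , X) ∈ Δ →
      proj₁ 𝒰 ≐ proj₁ 𝒰₀ →
      formal V ≐ᶠ var X →
      Δ ⊢ call f & 𝒰 , V

    ⊢rec : ∀ {f 𝒰 X W V} (𝒜 : 𝓜*) (𝒱 : Expression) →
      (X-fresh : (f & 𝒰 , X) # Δ) →
      Formal.coeff (formal 𝒱) X ≐ ∅ →
      cons (f & 𝒰 , X) Δ X-fresh ⊢ P f & 𝒰 , W →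
      formal W ≐ᶠ proj₁ 𝒜 ∙ᶠ var X ∪ᶠ formal 𝒱 →
      formal V ≐ᶠ proj₁ 𝒜 ⋆ᵃ ∙ᶠ formal 𝒱 ∪ᶠ constant (proj₁ 𝒜 ωᵃ) →
      Δ ⊢ call f & 𝒰 , V

  -- An element of 𝓜ω as an expression without variables.
  closed : 𝓜ω → Expression
  closed ℬ = record { coeff = λ _ → (∅ , λ _ ()) ; const = ℬ }

{-# OPTIONS --safe #-}

-- An expression e is typed by α* of the words it returns and by a formal
-- expression whose coefficient at the variable of a bound g describes the
-- words on which e reaches a tail call of g, and whose constant describes
-- the divergent words.  Procedures are bound one after the other, so rule
-- (v) eliminates the states of the finite graph of tail calls, as in
-- Kleene's theorem.  By König's lemma an infinite trace is an infinite path
-- in this graph; it passes the procedure f of rule (v) infinitely often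
-- (𝒜^ω) or has a last visit of f (𝒜* · 𝒱).
--
-- The constant ℬ of the type only needs Div(f) ⊆ 𝔤 ℬ and ℬ ⊆ αω (Div(f)),
-- Div(f) being the divergent words of f.  These suffice because a language
-- CD^ω that meets L(𝔄) is contained in it.  Ramsey's theorem, applied to the
-- finitely many classes of factors, shows that U^ω ⊆ 𝔤 (αω (U^ω)) and that
-- αω (U^ω) depends on U only up to ≈.

module Submission where

open import Defs
open import Algebra.Bundles using (Monoid)
open import Axiom.ExcludedMiddle using (ExcludedMiddle)
open import Data.Empty using (⊥-elim)
open import Data.Fin.Base using (Fin; zero; suc; toℕ; fromℕ<; combine; funToFin; finToFun)
open import Data.Fin.Properties using (combine-injective; finToFun-funToFin; toℕ-fromℕ<) renaming (_≟_ to _≟ᶠ_)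
open import Data.Fin.Subset using (Subset; inside; outside; _-_; ⊤; ∣_∣) renaming (_∈_ to _∈ˢ_; _∉_ to _∉ˢ_)
open import Data.Fin.Subset.Properties using (_∈?_; ∣p∣≤n; ∈⊤; x∈p∧x≢y⇒x∈p-y; p─q⊆p; x∈p⇒∣p-x∣<∣p∣)
open import Data.List.Base using (List; []; _∷_; [_]; _++_; length; concat; applyUpTo)
open import Data.List.Fresh using ([]; cons; _#_)
open import Data.List.Fresh.Relation.Unary.Any using (here; there)
open import Data.List.Properties using (∷-injectiveˡ; ∷-injectiveʳ; ++-assoc; ++-identityʳ; ++-cancelˡ; length-++; length-applyUpTo; catMaybes-++)
open import Data.List.Relation.Binary.Pointwise using (≡⇒Pointwise-≡; Pointwise-≡⇒≡)
open import Data.List.Relation.Binary.Prefix.Heterogeneous using (Prefix; []; _∷_)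
open import Data.List.Relation.Binary.Prefix.Heterogeneous.Properties as Prefixₚ using (length-mono; fromPointwise)
open import Data.List.Relation.Unary.All as All using (All; []; _∷_)
open import Data.Maybe.Base using (just)
open import Data.Nat.Base using (ℕ; zero; suc; _+_; _*_; _^_; _∸_; _⊔_; _≤_; _<_; z≤n; s≤s; _≤‴_; ≤‴-refl; ≤‴-step)
open import Data.Nat.GeneralisedArithmetic using (fold)
open import Data.Nat.Properties as ℕₚ using (≤-refl; ≤-trans; ≤-reflexive; ≤-total; <⇒≤)
open import Data.Product.Base using (Σ; ∃; ∃₂; _×_; _,_; proj₁; proj₂)
open import Data.Sum.Base using (_⊎_; inj₁; inj₂; [_,_]′)
open import Data.Unit.Base using (tt) renaming (⊤ to Unit)
open import Data.Vec.Base using (_∷_; there)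
open import Function.Base using (_∘_; id)
open import Function.Bundles using (_⇔_; mk⇔; _↣_; Equivalence; Injection)
open import Level using (0ℓ)
open import Relation.Binary.PropositionalEquality using (_≡_; _≢_; refl; sym; trans; cong; cong₂; subst; _≗_; module ≡-Reasoning)
open import Relation.Nullary using (¬_; Dec; yes; no)
open import Relation.Nullary.Decidable using (decidable-stable)
open import Relation.Unary using (Pred; _⊆_; _≐_; _∪_; ∅; ｛_｝)
open import Relation.Unary.Properties using (≐-refl; ≐-sym; ≐-trans)

-- Words and limits

-- Rule (v) demands that the body return exactly the set `𝒰` assumed for the procedure. No fixed
-- point has to be computed for it: `α*` of the words that are actually returned is the same for a
-- call and for its body, since `θ` erases the ✓ of the call. So every `𝒰` is known in advance, and
-- only the second component needs an induction.
--
-- The obstacle there is the empty word. A loop of calls may emit no visible letter, so a product of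
-- infinitely many factors can be finite. On the side of traces the ✓ of each call keeps the
-- unerased trace infinite; on the side of classes the empty word forms a class of its own, so that
-- after regrouping into factors of one class `D` either all factors are empty or none is.
--
-- The two bounds on `ℬ` are propagated on different levels. The upper one lives on pairs and is
-- preserved by replacing words by equivalent ones; the lower one lives on words and is preserved by
-- factorising them. Excluded middle enters through the pigeonhole principle, the finite coding of
-- classes, and the case distinctions on infinite behaviour.

module _ {A : Set} where

  infix 4 _≼_

  _≼_ : List A → List A → Set
  _≼_ = Prefix _≡_

  ≼-reflexive : ∀ {u v} → u ≡ v → u ≼ v
  ≼-reflexive eq = fromPointwise (≡⇒Pointwise-≡ eq)

  ≼-trans : ∀ {u v w} → u ≼ v → v ≼ w → u ≼ w
  ≼-trans = Prefixₚ.trans trans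

  ≼-++ : ∀ u {v} → u ≼ u ++ v
  ≼-++ []      = []
  ≼-++ (a ∷ u) = refl ∷ ≼-++ u

  ≼⇒++ : ∀ {u w} → u ≼ w → ∃ λ v → u ++ v ≡ w
  ≼⇒++ []         = _ , refl
  ≼⇒++ (refl ∷ p) with ≼⇒++ p
  ... | v , refl = v , refl

  ++⁺-≼ : ∀ u {v w} → v ≼ w → u ++ v ≼ u ++ w
  ++⁺-≼ []      p = p
  ++⁺-≼ (a ∷ u) p = refl ∷ ++⁺-≼ u p

  ++⁻-≼ : ∀ u {v w} → u ++ v ≼ u ++ w → v ≼ w
  ++⁻-≼ _ = Prefixₚ.++⁻ refl

  applyUpTo-cong : ∀ {x y : ℕ → A} → x ≗ y → ∀ n → applyUpTo x n ≡ applyUpTo y n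
  applyUpTo-cong eq zero    = refl
  applyUpTo-cong eq (suc n) = cong₂ _∷_ (eq 0) (applyUpTo-cong (eq ∘ suc) n)

  applyUpTo-mono : ∀ (x : ℕ → A) {m n} → m ≤ n → applyUpTo x m ≼ applyUpTo x n
  applyUpTo-mono x z≤n       = []
  applyUpTo-mono x (s≤s m≤n) = refl ∷ applyUpTo-mono (x ∘ suc) m≤n

  applyUpTo-+ : ∀ (x : ℕ → A) m n →
    applyUpTo x (m + n) ≡ applyUpTo x m ++ applyUpTo (λ i → x (m + i)) n
  applyUpTo-+ x zero    n = refl
  applyUpTo-+ x (suc m) n = cong (x 0 ∷_) (applyUpTo-+ (x ∘ suc) m n)

  ≼-applyUpTo : ∀ {u} (x : ℕ → A) n → u ≼ applyUpTo x n → u ⊑ inf x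
  ≼-applyUpTo {[]}    x n       p          = refl
  ≼-applyUpTo {_ ∷ _} x zero    ()
  ≼-applyUpTo {_ ∷ _} x (suc n) (refl ∷ p) = cong (x 0 ∷_) (≼-applyUpTo (x ∘ suc) n p)

  applyUpTo-⊑ : ∀ (x : ℕ → A) n → applyUpTo x n ⊑ inf x
  applyUpTo-⊑ x n = ≼-applyUpTo x n (≼-reflexive refl)

  applyUpTo-prepend : ∀ u (x : ℕ → A) n →
    applyUpTo (prepend u x) (length u + n) ≡ u ++ applyUpTo x n
  applyUpTo-prepend []      x n = refl
  applyUpTo-prepend (a ∷ u) x n = cong (a ∷_) (applyUpTo-prepend u x n)

  ≋-refl : ∀ {w : Word A} → w ≋ w
  ≋-refl {fin _} = fin refl
  ≋-refl {inf _} = inf λ _ → refl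

  ≋-sym : ∀ {w w′ : Word A} → w ≋ w′ → w′ ≋ w
  ≋-sym (fin eq) = fin (sym eq)
  ≋-sym (inf eq) = inf λ n → sym (eq n)

  ≋-trans : ∀ {u v w : Word A} → u ≋ v → v ≋ w → u ≋ w
  ≋-trans (fin p) (fin q) = fin (trans p q)
  ≋-trans (inf p) (inf q) = inf λ n → trans (p n) (q n)

  ·-congʳ : ∀ u {v w : Word A} → v ≋ w → u · v ≋ u · w
  ·-congʳ u       (fin refl) = fin refl
  ·-congʳ []      (inf eq)   = inf eq
  ·-congʳ (a ∷ u) (inf eq) with ·-congʳ u (inf eq)
  ... | inf eq′ = inf λ { zero → refl ; (suc n) → eq′ n }

  ·-assoc : ∀ u v (w : Word A) → (u ++ v) · w ≋ u · (v · w)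
  ·-assoc u       v (fin w) = fin (++-assoc u v w)
  ·-assoc []      v (inf x) = ≋-refl
  ·-assoc (a ∷ u) v (inf x) with ·-assoc u v (inf x)
  ... | inf eq = inf λ { zero → refl ; (suc n) → eq n }

  []-· : ∀ (w : Word A) → [] · w ≋ w
  []-· (fin _) = ≋-refl
  []-· (inf _) = ≋-refl

  ⊑-resp-≋ : ∀ {u} {w w′ : Word A} → w ≋ w′ → u ⊑ w → u ⊑ w′
  ⊑-resp-≋ (fin refl) p = p
  ⊑-resp-≋ (inf eq)   p = trans p (applyUpTo-cong eq _)

  ≼-⊑-trans : ∀ {u v} {w : Word A} → u ≼ v → v ⊑ w → u ⊑ w
  ≼-⊑-trans {w = fin _} p q = ≼-trans p q
  ≼-⊑-trans {w = inf x} p q = ≼-applyUpTo x _ (subst (_ ≼_) q p)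

  ⊑-·⁺ : ∀ u {v} {w : Word A} → v ⊑ w → u ++ v ⊑ u · w
  ⊑-·⁺ u       {w = fin _} p = ++⁺-≼ u p
  ⊑-·⁺ []      {w = inf _} p = p
  ⊑-·⁺ (a ∷ u) {w = inf x} p = cong (a ∷_) (⊑-·⁺ u {w = inf x} p)

  ⊑-·⁻ : ∀ u {v} {w : Word A} → u ++ v ⊑ u · w → v ⊑ w
  ⊑-·⁻ u       {w = fin _} p = ++⁻-≼ u p
  ⊑-·⁻ []      {w = inf _} p = p
  ⊑-·⁻ (a ∷ u) {w = inf x} p = ⊑-·⁻ u {w = inf x} (∷-injectiveʳ p)

  ⊑-· : ∀ u {w : Word A} → u ⊑ u · w
  ⊑-· u {fin w} = ≼-++ u
  ⊑-· u {inf x} = subst (_⊑ u · inf x) (++-identityʳ u) (⊑-·⁺ u {w = inf x} refl)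

  ⊑⇒· : ∀ {u} {w : Word A} → u ⊑ w → ∃ λ v → u · v ≋ w
  ⊑⇒· {w = fin w} p with ≼⇒++ p
  ... | v , eq = fin v , fin eq
  ⊑⇒· {u} {inf x} p = inf (λ n → x (length u + n)) , inf (go u x p)
    where
    go : ∀ u x → u ⊑ inf x → ∀ n → prepend u (λ n → x (length u + n)) n ≡ x n
    go []      x p n       = refl
    go (a ∷ u) x p zero    = ∷-injectiveˡ p
    go (a ∷ u) x p (suc n) = go u (x ∘ suc) (∷-injectiveʳ p) n

  ⊑-linear : ∀ {u v} {w : Word A} → u ⊑ w → v ⊑ w → length u ≤ length v → u ≼ v
  ⊑-linear {w = fin w} p q l = go p q l
    where
    go : ∀ {u v w} → u ≼ w → v ≼ w → length u ≤ length v → u ≼ v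
    go []         q          l       = []
    go (refl ∷ p) (refl ∷ q) (s≤s l) = refl ∷ go p q l
  ⊑-linear {w = inf x} p q l =
    subst (_≼ _) (sym p) (subst (_ ≼_) (sym q) (applyUpTo-mono x l))

  Limit-cofinal : ∀ {s s′ : ℕ → List A} {w} →
    (∀ n → ∃ λ m → s′ n ≼ s m) → (∀ n → ∃ λ m → s n ≼ s′ m) → Limit s w → Limit s′ w
  Limit-cofinal f g lim = record
    { upper = λ n → ≼-⊑-trans (proj₂ (f n)) (upper _)
    ; least = λ u u⊑w → let (n , p) = least u u⊑w ; (m , q) = g n in m , ≼-trans p q
    }
    where open Limit lim

  Limit-resp-≗ : ∀ {s s′ : ℕ → List A} {w} → (∀ n → s n ≡ s′ n) → Limit s w → Limit s′ w
  Limit-resp-≗ eq = Limit-cofinal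
    (λ n → n , ≼-reflexive (sym (eq n))) (λ n → n , ≼-reflexive (eq n))

  Limit-resp-≋ : ∀ {s : ℕ → List A} {w w′} → w ≋ w′ → Limit s w → Limit s w′
  Limit-resp-≋ eq lim = record
    { upper = λ n → ⊑-resp-≋ eq (upper n)
    ; least = λ u p → least u (⊑-resp-≋ (≋-sym eq) p)
    }
    where open Limit lim

  Limit-++⁺ : ∀ u {s : ℕ → List A} {w} → Limit s w → Limit (λ n → u ++ s n) (u · w)
  Limit-++⁺ u {s} {w} lim = record { upper = λ n → ⊑-·⁺ u (upper n) ; least = least′ }
    where
    open Limit lim
    least′ : ∀ z → z ⊑ u · w → ∃ λ n → z ≼ u ++ s n
    least′ z p with ≤-total (length z) (length u)
    ... | inj₁ l = 0 , ≼-trans (⊑-linear p (⊑-· u) l) (≼-++ u)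
    ... | inj₂ l with ≼⇒++ (⊑-linear (⊑-· u) p l)
    ... | y , refl with least y (⊑-·⁻ u p)
    ... | n , q = n , ++⁺-≼ u q

  Limit-++⁻ : ∀ u {s : ℕ → List A} {w} → Limit (λ n → u ++ s n) (u · w) → Limit s w
  Limit-++⁻ u lim = record
    { upper = λ n → ⊑-·⁻ u (upper n)
    ; least = λ z p → let (n , q) = least (u ++ z) (⊑-·⁺ u p) in n , ++⁻-≼ u q
    }
    where open Limit lim

  Limit-factor : ∀ u {s : ℕ → List A} {w} → Limit (λ n → u ++ s n) w →
    ∃ λ v → u · v ≋ w × Limit s v
  Limit-factor u lim with ⊑⇒· (≼-⊑-trans (≼-++ u) (Limit.upper lim 0))
  ... | v , eq = v , eq , Limit-++⁻ u (Limit-resp-≋ (≋-sym eq) lim)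

  Limit-inf : ∀ {s : ℕ → List A} {x} → (∀ n → s n ⊑ inf x) →
    (∀ n → ∃ λ m → n ≤ length (s m)) → Limit s (inf x)
  Limit-inf upper long = record
    { upper = upper
    ; least = λ u u⊑x → let (m , l) = long (length u) in m , ⊑-linear u⊑x (upper m) l
    }

  Limit-suc : ∀ {s : ℕ → List A} {w} → s 0 ≡ [] → Limit s w → Limit (s ∘ suc) w
  Limit-suc {s} eq = Limit-cofinal (λ n → suc n , ≼-reflexive refl)
    λ { zero    → 0 , subst (_≼ s 1) (sym eq) []
      ; (suc n) → n , ≼-reflexive refl }

  concatTo : (ℕ → List A) → ℕ → List A
  concatTo d n = concat (applyUpTo d n)

  concatTo-+ : ∀ d m n → concatTo d (m + n) ≡ concatTo d m ++ concatTo (λ i → d (m + i)) n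
  concatTo-+ d zero    n = refl
  concatTo-+ d (suc m) n =
    trans (cong (d 0 ++_) (concatTo-+ (d ∘ suc) m n)) (sym (++-assoc (d 0) _ _))

  concatTo-suc : ∀ d n → concatTo d (suc n) ≡ concatTo d n ++ d n
  concatTo-suc d zero    = ++-identityʳ (d 0)
  concatTo-suc d (suc n) =
    trans (cong (d 0 ++_) (concatTo-suc (d ∘ suc) n)) (sym (++-assoc (d 0) _ _))

  concatTo-mono : ∀ d {m n} → m ≤ n → concatTo d m ≼ concatTo d n
  concatTo-mono d z≤n       = []
  concatTo-mono d (s≤s m≤n) = ++⁺-≼ (d 0) (concatTo-mono (d ∘ suc) m≤n)

  concatTo-unique : ∀ {s : ℕ → List A} d → (∀ n → s (suc n) ≡ s n ++ d n) →
    ∀ n → s n ≡ s 0 ++ concatTo d n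
  concatTo-unique d step zero    = sym (++-identityʳ _)
  concatTo-unique {s} d step (suc n) = begin
    s (suc n)                  ≡⟨ step n ⟩
    s n ++ d n                 ≡⟨ cong (_++ d n) (concatTo-unique d step n) ⟩
    (s 0 ++ concatTo d n) ++ d n ≡⟨ ++-assoc (s 0) _ _ ⟩
    s 0 ++ concatTo d n ++ d n ≡⟨ cong (s 0 ++_) (concatTo-suc d n) ⟨
    s 0 ++ concatTo d (suc n)  ∎
    where open ≡-Reasoning

  concatTo-long : ∀ d → (∀ i → d i ≢ []) → ∀ n → n ≤ length (concatTo d n)
  concatTo-long d d≢[] zero    = z≤n
  concatTo-long d d≢[] (suc n) with d 0 | d≢[] 0
  ... | []    | ≢[] = ⊥-elim (≢[] refl)
  ... | a ∷ u | _   = s≤s (≤-trans (concatTo-long (d ∘ suc) (d≢[] ∘ suc) n)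
    (≤-trans (ℕₚ.m≤n+m _ (length u)) (≤-reflexive (sym (length-++ u)))))

  -- The current block is `a ∷ u`, the later ones are `h i ∷ t i`. With the heads split off, each
  -- position yields a letter at once, so the recursion is structural in the position.
  flatten : A → List A → (ℕ → A) → (ℕ → List A) → ℕ → A
  flatten a u       h t zero    = a
  flatten a (b ∷ u) h t (suc n) = flatten b u h t n
  flatten a []      h t (suc n) = flatten (h 0) (t 0) (h ∘ suc) (t ∘ suc) n

  flatten-⊑ : ∀ a u h t n →
    a ∷ u ++ concatTo (λ i → h i ∷ t i) n ⊑ inf (flatten a u h t)
  flatten-⊑ a (b ∷ u) h t n       = cong (a ∷_) (flatten-⊑ b u h t n)
  flatten-⊑ a []      h t zero    = refl
  flatten-⊑ a []      h t (suc n) =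
    cong (a ∷_) (flatten-⊑ (h 0) (t 0) (h ∘ suc) (t ∘ suc) n)

  concatTo-Limit : ∀ h t → ∃ λ x → Limit (concatTo (λ i → h i ∷ t i)) (inf x)
  concatTo-Limit h t =
    flatten (h 0) (t 0) (h ∘ suc) (t ∘ suc) ,
    Limit-inf
      (λ { zero → refl ; (suc n) → flatten-⊑ (h 0) (t 0) (h ∘ suc) (t ∘ suc) n })
      (λ n → n , concatTo-long (λ i → h i ∷ t i) (λ _ ()) n)

-- Infinite Ramsey theorem

Increasing : (ℕ → ℕ) → Set
Increasing φ = ∀ i → φ i < φ (suc i)

increasing-≤ : ∀ {φ} → Increasing φ → ∀ n → n ≤ φ n
increasing-≤ inc zero    = z≤n
increasing-≤ inc (suc n) = ≤-trans (s≤s (increasing-≤ inc n)) (inc n)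

increasing-mono : ∀ {φ} → Increasing φ → ∀ {i j} → i < j → φ i < φ j
increasing-mono {φ} inc {i} {suc j} (s≤s i≤j) with ℕₚ.m≤n⇒m<n∨m≡n i≤j
... | inj₁ i<j  = ℕₚ.<-trans (increasing-mono inc i<j) (inc j)
... | inj₂ refl = inc i

Limit-increasing : ∀ {A : Set} {s : ℕ → List A} {w} φ → Increasing φ →
  (∀ {m n} → m ≤ n → s m ≼ s n) → Limit s w → Limit (s ∘ φ) w
Limit-increasing φ inc mono = Limit-cofinal
  (λ n → φ n , ≼-reflexive refl) (λ n → n , mono (increasing-≤ inc n))

InfinitelyOften : Pred ℕ 0ℓ → Set
InfinitelyOften S = ∀ n → ∃ λ m → n ≤ m × S m

always : InfinitelyOften λ _ → Unit
always n = n , ≤-refl , tt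

select : ∀ {S} → InfinitelyOften S → ∃ λ φ → Increasing φ × ∀ i → S (φ i)
select {S} io = φ , (λ i → proj₁ (proj₂ (io (suc (φ i))))) ,
  λ { zero → proj₂ (proj₂ (io 0)) ; (suc i) → proj₂ (proj₂ (io (suc (φ i)))) }
  where
  φ : ℕ → ℕ
  φ zero    = proj₁ (io 0)
  φ (suc i) = proj₁ (io (suc (φ i)))

uniform-bound : ∀ {K} {Q : Fin K → ℕ → Set} → (∀ {k m n} → m ≤ n → Q k m → Q k n) →
  (∀ k → ∃ (Q k)) → ∃ λ n → ∀ k → Q k n
uniform-bound {zero}  mono bound = 0 , λ ()
uniform-bound {suc K} mono bound
  with bound zero | uniform-bound {K} mono (bound ∘ suc)
... | m , q | n , qs = m ⊔ n , λ where
  zero    → mono (ℕₚ.m≤m⊔n m n) q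
  (suc k) → mono (ℕₚ.m≤n⊔m m n) (qs k)

module Classical (em : ExcludedMiddle 0ℓ) where

  ¬∀⇒∃¬ : ∀ {A : Set} {P : A → Set} → ¬ (∀ a → P a) → ∃ λ a → ¬ P a
  ¬∀⇒∃¬ {A} {P} ¬∀ with em {∃ λ a → ¬ P a}
  ... | yes e = e
  ... | no ¬e = ⊥-elim (¬∀ λ a → decidable-stable em λ ¬p → ¬e (a , ¬p))

  ¬io⇒bounded : ∀ {S} → ¬ InfinitelyOften S → ∃ λ n → ∀ m → n ≤ m → ¬ S m
  ¬io⇒bounded ¬io with ¬∀⇒∃¬ ¬io
  ... | n , ¬S = n , λ m n≤m s → ¬S (m , n≤m , s)

  -- If every colour were bounded within `S`, a common bound for the finitely many colours would
  -- bound `S` itself.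
  pigeonhole : ∀ {K S} → InfinitelyOften S → (c : ℕ → Fin K) →
    ∃ λ k → InfinitelyOften (λ m → S m × c m ≡ k)
  pigeonhole {K} {S} io c with em {∃ λ k → InfinitelyOften (λ m → S m × c m ≡ k)}
  ... | yes e = e
  ... | no ¬e with uniform-bound {Q = λ k n → ∀ m → n ≤ m → ¬ (S m × c m ≡ k)}
                     (λ l q m m≥ → q m (≤-trans l m≥))
                     (λ k → ¬io⇒bounded λ io′ → ¬e (k , io′))
  ... | n , none with io n
  ... | m , n≤m , s = ⊥-elim (none (c m) m n≤m (s , refl))

  module _ {K : ℕ} (c : ℕ → ℕ → Fin K) where

    private
      -- Nested pools: `point` sees infinitely many members of `pool` in one colour, and these form
      -- the next pool, from which the next point is taken. Hence the colour of a pair of points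
      -- depends only on the earlier one, and one more pigeonhole over the stages makes it constant.
      record Stage : Set₁ where
        field
          point    : ℕ
          pool     : Pred ℕ 0ℓ
          infinite : InfinitelyOften pool

        hole : ∃ λ k → InfinitelyOften (λ j → pool j × c point j ≡ k)
        hole = pigeonhole infinite (c point)

        colour : Fin K
        colour = proj₁ hole

        pool′ : Pred ℕ 0ℓ
        pool′ j = point < j × pool j × c point j ≡ colour

        infinite′ : InfinitelyOften pool′
        infinite′ n with proj₂ hole (n ⊔ suc point)
        ... | j , l , p = j , ≤-trans (ℕₚ.m≤m⊔n n _) l , ≤-trans (ℕₚ.m≤n⊔m n _) l , p

      open Stage

      next : Stage → Stage
      next st = record
        { point    = proj₁ (infinite′ st 0)
        ; pool     = pool′ st
        ; infinite = infinite′ st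
        }

      stage : ℕ → Stage
      stage zero    = record { point = 0 ; pool = λ _ → Unit ; infinite = always }
      stage (suc n) = next (stage n)

      point∈pool : ∀ n → pool′ (stage n) (point (stage (suc n)))
      point∈pool n = proj₂ (proj₂ (infinite′ (stage n) 0))

      pool′-antitone : ∀ {m n} → m ≤ n → pool′ (stage n) ⊆ pool′ (stage m)
      pool′-antitone {m} {n} m≤n p with ℕₚ.m≤n⇒m<n∨m≡n m≤n
      pool′-antitone {m} {suc n} _ p | inj₁ (s≤s m≤n) = pool′-antitone m≤n (proj₁ (proj₂ p))
      pool′-antitone _ p | inj₂ refl = p

      stage-colour : ∀ {m n} → m < n → c (point (stage m)) (point (stage n)) ≡ colour (stage m)
      stage-colour {m} {suc n} (s≤s m≤n) = proj₂ (proj₂ (pool′-antitone m≤n (point∈pool n)))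

    ramsey : ∃₂ λ φ k → Increasing φ × ∀ {i j} → i < j → c (φ i) (φ j) ≡ k
    ramsey with pigeonhole always (colour ∘ stage)
    ... | k , io with select io
    ... | ψ , inc , col = point ∘ stage ∘ ψ , k ,
      (λ i → increasing-mono (λ n → proj₁ (point∈pool n)) (inc i)) ,
      λ {i} i<j → trans (stage-colour (increasing-mono inc i<j)) (proj₂ (col i))

module Segments {A : Set} (d : ℕ → List A) where

  segment : ℕ → ℕ → List A
  segment i j = concatTo (λ l → d (i + l)) (j ∸ i)

  concatTo-segment : ∀ {i j} → i ≤ j → concatTo d j ≡ concatTo d i ++ segment i j
  concatTo-segment {i} {j} i≤j =
    trans (cong (concatTo d) (sym (ℕₚ.m+[n∸m]≡n i≤j))) (concatTo-+ d i (j ∸ i))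

  segment-++ : ∀ {i j k} → i ≤ j → j ≤ k → segment i k ≡ segment i j ++ segment j k
  segment-++ {i} {j} {k} i≤j j≤k = ++-cancelˡ (concatTo d i) _ _ (begin
    concatTo d i ++ segment i k                  ≡⟨ concatTo-segment (≤-trans i≤j j≤k) ⟨
    concatTo d k                                 ≡⟨ concatTo-segment j≤k ⟩
    concatTo d j ++ segment j k                  ≡⟨ cong (_++ segment j k) (concatTo-segment i≤j) ⟩
    (concatTo d i ++ segment i j) ++ segment j k ≡⟨ ++-assoc (concatTo d i) _ _ ⟩
    concatTo d i ++ segment i j ++ segment j k   ∎)
    where open ≡-Reasoning

open Segments using (segment; concatTo-segment; segment-++)

-- Classes of words and closed sets of pairs

module Classes {s : ℕ} (𝔄 : Automaton s) where

  open Automaton 𝔄 using (states; q₀; δ)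
  open Abstraction 𝔄
  module ≈ = Monoid 𝒬

  ~-refl : ∀ {w} → w ~ w
  ~-refl p q = mk⇔ id id , mk⇔ id id

  ≈⇒~ : ∀ {w u} → w ≈ u → w ~ u
  ≈⇒~ ε≈ε     = ~-refl
  ≈⇒~ (~⇒≈ e) = e

  concatTo-cong : ∀ {d d′ : ℕ → Q} → (∀ i → d i ≈ d′ i) → ∀ n → concatTo d n ≈ concatTo d′ n
  concatTo-cong eq zero    = ≈.refl
  concatTo-cong eq (suc n) = ≈.∙-cong (eq 0) (concatTo-cong (eq ∘ suc) n)

  segment-cong : ∀ {d d′ : ℕ → Q} → (∀ i → d i ≈ d′ i) → ∀ i j → segment d i j ≈ segment d′ i j
  segment-cong eq i j = concatTo-cong (λ l → eq (i + l)) (j ∸ i)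

  ^ω-resp-≋ : ∀ {C D w w′} → w ≋ w′ → (C [ D ]^ω) w → (C [ D ]^ω) w′
  ^ω-resp-≋ eq (u , v , p , q , r) = u , v , p , q , ≋-trans r eq

  ^ω-resp-≈ : ∀ {C C′ D D′ w} → C ≈ C′ → D ≈ D′ → (C [ D ]^ω) w → (C′ [ D′ ]^ω) w
  ^ω-resp-≈ C≈ D≈ (u , v , p , (ws , q , l) , r) =
    u , v , ≈.trans (≈.sym C≈) p , (ws , (λ i → ≈.trans (≈.sym D≈) (q i)) , l) , r

  ^ω-∙ : ∀ {A C D a w} → A ≈ a → (C [ D ]^ω) w → ((A ∙ C) [ D ]^ω) (a · w)
  ^ω-∙ {a = a} A≈a (u , v , p , q , r) =
    a ++ u , v , ≈.∙-cong A≈a p , q , ≋-trans (·-assoc a u v) (·-congʳ a r)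

  ^ω-intro : ∀ {C D w} {t d : ℕ → Q} → C ≈ t 0 → (∀ n → t (suc n) ≡ t n ++ d n) →
    (∀ n → D ≈ d n) → Limit t w → (C [ D ]^ω) w
  ^ω-intro {t = t} {d} C≈ step D≈ lim
    with Limit-factor (t 0) (Limit-resp-≗ (concatTo-unique d step) lim)
  ... | v , eq , lim′ = t 0 , v , C≈ , (d , D≈ , lim′) , eq

  ^ω-elim : ∀ {C D w} → (C [ D ]^ω) w → ∃₂ λ u d →
    C ≈ u × (∀ n → D ≈ d n) × Limit (λ n → u ++ concatTo d n) w
  ^ω-elim (u , v , C≈ , (d , D≈ , lim) , eq) =
    u , d , C≈ , D≈ , Limit-resp-≋ eq (Limit-++⁺ u lim)

  𝒞-resp-≈ : ∀ {C C′ D D′} → C ≈ C′ → D ≈ D′ → 𝒞 (C , D) → 𝒞 (C′ , D′)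
  𝒞-resp-≈ C≈ D≈ (CD≈C , DD≈D) =
    ≈.trans (≈.∙-cong (≈.sym C≈) (≈.sym D≈)) (≈.trans CD≈C C≈) ,
    ≈.trans (≈.∙-cong (≈.sym D≈) (≈.sym D≈)) (≈.trans DD≈D D≈)

  𝒞-∙ : ∀ A {C D} → 𝒞 (C , D) → 𝒞 (A ∙ C , D)
  𝒞-∙ A {C} {D} (CD≈C , DD≈D) =
    ≈.trans (≈.assoc A C D) (≈.∙-cong (≈.refl {A}) CD≈C) , DD≈D

  C∙Dⁿ : ∀ {C D u} {d : ℕ → Q} → 𝒞 (C , D) → C ≈ u → (∀ n → D ≈ d n) →
    ∀ n → u ++ concatTo d n ≈ C
  C∙Dⁿ {u = u} c C≈ D≈ zero    = ≈.trans (≈.reflexive (++-identityʳ u)) (≈.sym C≈)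
  C∙Dⁿ {C} {D} {u} {d} c C≈ D≈ (suc n) =
    ≈.trans (≈.reflexive (sym (++-assoc u (d 0) _)))
      (C∙Dⁿ {d = d ∘ suc} c (≈.trans (≈.sym (proj₁ c)) (≈.∙-cong C≈ (D≈ 0))) (D≈ ∘ suc) n)

  𝔤-mono : ∀ {𝒱 𝒱′ : Pred (Q × Q) 0ℓ} → 𝒱 ⊆ 𝒱′ → 𝔤 𝒱 ⊆ 𝔤 𝒱′
  𝔤-mono sub (C , D , p , q) = C , D , sub p , q

  𝔣-mono : ∀ {V V′ : Pred (Word (Fin s)) 0ℓ} → V ⊆ V′ → 𝔣 V ⊆ 𝔣 V′
  𝔣-mono sub (c , w , p , q) = c , w , p , sub q

  -- The fixed points of `𝔣 ∘ 𝔤` are exactly the members of `𝓜ω`, by `Closed⇒𝓜ω` and `𝓜ω-Closed`.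
  -- This local condition is what gets checked for the abstract operations, in place of guessing a
  -- language `V`.
  Closed : Pred (Q × Q) 0ℓ → Set
  Closed 𝒱 = 𝒱 ≐ 𝔣 (𝔤 𝒱)

  -- `𝔠` is a union of iterates, so induction on the stage applies; this is the induction principle
  -- behind every upper bound on `αω`.
  αω-least : ∀ {V : Pred (Word (Fin s)) 0ℓ} {𝒱 : Pred (Q × Q) 0ℓ} →
    𝔣 V ⊆ 𝒱 → 𝔣 (𝔤 𝒱) ⊆ 𝒱 → αω V ⊆ 𝒱
  αω-least {V} {𝒱} base step (n , _ , p) = go n p
    where
    go : ∀ n → fold (𝔣 V) (𝔣 ∘ 𝔤) n ⊆ 𝒱
    go zero    p = base p
    go (suc n) p = step (𝔣-mono (𝔤-mono (go n)) p)

  -- The union in `𝔠` starts at one iteration. A pair of `𝔣 V` survives it because the word it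
  -- shares with `V` lies in `𝔤 (𝔣 V)` through that same pair.
  𝔣⊆αω : ∀ {V : Pred (Word (Fin s)) 0ℓ} → 𝔣 V ⊆ αω V
  𝔣⊆αω (c , w , p , q) = 1 , ≤-refl , c , w , p , (_ , _ , (c , w , p , q) , p)

  αω-step : ∀ {V : Pred (Word (Fin s)) 0ℓ} → 𝔣 (𝔤 (αω V)) ⊆ αω V
  αω-step (c , w , p , (C , D , (n , _ , q) , r)) = suc n , s≤s z≤n , c , w , p , (C , D , q , r)

  αω-Closed : ∀ {V : Pred (Word (Fin s)) 0ℓ} → Closed (αω V)
  αω-Closed {V} = (λ { {CD} (suc n , _ , c , w , p , q) →
    c , w , p , (proj₁ CD , proj₂ CD , (suc n , s≤s z≤n , c , w , p , q) , p) }) , αω-step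

  αω-mono : ∀ {V V′ : Pred (Word (Fin s)) 0ℓ} → V ⊆ V′ → αω V ⊆ αω V′
  αω-mono sub = αω-least (𝔣⊆αω ∘ 𝔣-mono sub) αω-step

  Closed-resp-≐ : ∀ {𝒱 𝒱′ : Pred (Q × Q) 0ℓ} → 𝒱 ≐ 𝒱′ → Closed 𝒱 → Closed 𝒱′
  Closed-resp-≐ (f , g) (h , k) = 𝔣-mono (𝔤-mono f) ∘ h ∘ g , f ∘ k ∘ 𝔣-mono (𝔤-mono g)

  Closed⇒𝓜ω : ∀ {𝒱} → Closed 𝒱 → ∃ λ V → 𝒱 ≐ 𝔠 (𝔣 V)
  Closed⇒𝓜ω {𝒱} (f , g) = 𝔤 𝒱 , 𝔣⊆αω ∘ f , αω-least g g

  𝓜ω-Closed : (𝒱 : 𝓜ω) → Closed (proj₁ 𝒱)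
  𝓜ω-Closed (𝒱 , V , f , g) = Closed-resp-≐ (g , f) αω-Closed

  Closed-∅ : Closed ∅
  Closed-∅ = (λ ()) , λ { (_ , _ , _ , _ , _ , () , _) }

  Closed-∪ : ∀ {𝒱 𝒱′ : Pred (Q × Q) 0ℓ} → Closed 𝒱 → Closed 𝒱′ → Closed (𝒱 ∪ 𝒱′)
  Closed-∪ (f , g) (f′ , g′) =
    (λ { (inj₁ p) → 𝔣-mono (𝔤-mono inj₁) (f p) ; (inj₂ p) → 𝔣-mono (𝔤-mono inj₂) (f′ p) }) ,
    λ { (c , w , p , C , D , inj₁ q , r) → inj₁ (g (c , w , p , C , D , q , r))
      ; (c , w , p , C , D , inj₂ q , r) → inj₂ (g′ (c , w , p , C , D , q , r)) }

  -- A word of AC[D]^ω need not start with a word of A.  Its first factor u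
  -- is therefore replaced by C; the new word lies in C[D]^ω, and also in
  -- C″[D′]^ω with AC″ = C′, once a factorisation in C′[D′]^ω has passed u.
  Closed-∙ω : ∀ {𝒰 : Pred Q 0ℓ} {𝒱 : Pred (Q × Q) 0ℓ} → Closed 𝒱 → Closed (𝒰 ∙ω 𝒱)
  Closed-∙ω {𝒰} {𝒱} (f , g) = extend , close
    where
    extend : 𝒰 ∙ω 𝒱 ⊆ 𝔣 (𝔤 (𝒰 ∙ω 𝒱))
    extend {x , y} (A , C , D , a , p , AC≈x , D≈y) with f p
    ... | c , w , w∈ , _ =
      𝒞-resp-≈ AC≈x D≈y (𝒞-∙ A c) , A · w , Aw∈ ,
      (x , y , (A , C , D , a , p , AC≈x , D≈y) , Aw∈)
      where Aw∈ = ^ω-resp-≈ AC≈x D≈y (^ω-∙ (≈.refl {A}) w∈)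
    close : 𝔣 (𝔤 (𝒰 ∙ω 𝒱)) ⊆ 𝒰 ∙ω 𝒱
    close {C′ , D′} (c′ , w , w∈ , _ , _ , (A , C , D , a , p , AC≈x , D≈y) , (u , v , x≈u , v∈ , eq))
      with ^ω-elim w∈
    ... | u′ , d′ , C′≈u′ , D′≈d′ , lim
      with Limit.least lim u (⊑-resp-≋ eq (⊑-· u))
    ... | k , u≼ with ≼⇒++ u≼
    -- `z` is what the first `k` factors leave beyond `u`. It need not absorb `D′`, so one full
    -- factor `d′ k` is appended: idempotence of `D′` then gives the condition `c″`.
    ... | z , uz≡ = A , C ++ z ++ d′ k , D′ , a ,
                    g (c″ , C · v , Cv∈ , C , D , p , C , v , ≈.refl , v∈′ , ≋-refl) ,
                    AC″≈C′ , ≈.refl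
      where
      AC≈u : A ∙ C ≈ u
      AC≈u = ≈.trans AC≈x x≈u
      AC″≈C′ : A ∙ (C ++ z ++ d′ k) ≈ C′
      AC″≈C′ = ≈.trans (≈.reflexive (sym (++-assoc A C _)))
        (≈.trans (≈.∙-cong AC≈u (≈.refl {z ++ d′ k}))
        (≈.trans (≈.reflexive (begin
          u ++ z ++ d′ k                ≡⟨ ++-assoc u z _ ⟨
          (u ++ z) ++ d′ k              ≡⟨ cong (_++ d′ k) uz≡ ⟩
          (u′ ++ concatTo d′ k) ++ d′ k ≡⟨ ++-assoc u′ _ _ ⟩
          u′ ++ concatTo d′ k ++ d′ k   ≡⟨ cong (u′ ++_) (concatTo-suc d′ k) ⟨
          u′ ++ concatTo d′ (suc k)     ∎))
        (C∙Dⁿ {d = d′} c′ C′≈u′ D′≈d′ (suc k))))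
        where open ≡-Reasoning
      c″ : 𝒞 (C ++ z ++ d′ k , D′)
      c″ = ≈.trans (≈.reflexive (trans (++-assoc C (z ++ d′ k) D′) (cong (C ++_) (++-assoc z (d′ k) D′))))
             (≈.∙-cong (≈.refl {C}) (≈.∙-cong (≈.refl {z})
               (≈.trans (≈.∙-cong (≈.sym (D′≈d′ k)) (≈.refl {D′})) (≈.trans (proj₂ c′) (D′≈d′ k))))) ,
           proj₂ c′
      v∈′ : ((D ≈_) ^ω) v
      v∈′ = let (ws , q , l) = v∈ in ws , (λ i → ≈.trans D≈y (q i)) , l
      tail : ℕ → Q
      tail n = concatTo (λ i → d′ (k + i)) n
      lim′ : Limit (λ n → z ++ tail n) v
      lim′ = Limit-++⁻ u (Limit-resp-≋ (≋-sym eq) (Limit-resp-≗ {s = λ n → u′ ++ concatTo d′ (k + n)}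
        (λ n → begin
          u′ ++ concatTo d′ (k + n)       ≡⟨ cong (u′ ++_) (concatTo-+ d′ k n) ⟩
          u′ ++ concatTo d′ k ++ tail n   ≡⟨ ++-assoc u′ _ _ ⟨
          (u′ ++ concatTo d′ k) ++ tail n ≡⟨ cong (_++ tail n) uz≡ ⟨
          (u ++ z) ++ tail n              ≡⟨ ++-assoc u z _ ⟩
          u ++ z ++ tail n                ∎)
        (Limit-cofinal
          (λ n → k + n , ≼-reflexive refl)
          (λ n → n , ++⁺-≼ u′ (concatTo-mono d′ (ℕₚ.m≤n+m n k))) lim)))
        where open ≡-Reasoning
      Cv∈ : ((C ++ z ++ d′ k) [ D′ ]^ω) (C · v)
      -- The chain starts with one factor already consumed, hence `suc n`: its first member is the
      -- new first class `C ++ z ++ d′ k`.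
      Cv∈ = ^ω-intro {t = λ n → C ++ z ++ tail (suc n)} {d = λ n → d′ (k + suc n)}
        (≈.reflexive (cong (λ x → C ++ z ++ x) (sym (trans (++-identityʳ _) (cong d′ (ℕₚ.+-identityʳ k))))))
        (λ n → begin
          C ++ z ++ tail (suc (suc n))               ≡⟨ cong (λ x → C ++ z ++ x) (concatTo-suc (λ i → d′ (k + i)) (suc n)) ⟩
          C ++ z ++ tail (suc n) ++ d′ (k + suc n)   ≡⟨ cong (C ++_) (++-assoc z _ _) ⟨
          C ++ (z ++ tail (suc n)) ++ d′ (k + suc n) ≡⟨ ++-assoc C _ _ ⟨
          (C ++ z ++ tail (suc n)) ++ d′ (k + suc n) ∎)
        (λ n → D′≈d′ (k + suc n))
        (Limit-++⁺ C (Limit-cofinal (λ n → suc n , ≼-reflexive refl)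
          (λ n → n , ++⁺-≼ z (concatTo-mono (λ i → d′ (k + i)) (ℕₚ.n≤1+n n))) lim′))
        where open ≡-Reasoning

  α*-resp-≈ : ∀ U {C C′} → C ≈ C′ → α* U C → α* U C′
  α*-resp-≈ U C≈ (u , p , q) = u , ≈.trans (≈.sym C≈) p , q

  ∙*-resp-≈ : ∀ {𝒰 𝒰′ C C′} → C ≈ C′ → (𝒰 ∙* 𝒰′) C → (𝒰 ∙* 𝒰′) C′
  ∙*-resp-≈ C≈ (A , B , a , b , p) = A , B , a , b , ≈.trans p C≈

  -- Left multiplication passes through every stage of `αω`: the word that a pair shares with `V`,
  -- or with the preceding stage, is extended on the left by the representative `a` of `A` in `U`.
  ∙ω-αω : ∀ {U V} → α* U ∙ω αω V ⊆ αω (U ⊙ V)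
  ∙ω-αω {U} {V} {x , y} (A , C , D , (a , A≈a , a∈U) , p , AC≈x , D≈y) =
    αω-least {V} {λ { (C , D) → ∀ {x y} → A ∙ C ≈ x → D ≈ y → αω (U ⊙ V) (x , y) }}
      (λ { (c , w , p , q) AC≈x D≈y →
        𝔣⊆αω (𝒞-resp-≈ AC≈x D≈y (𝒞-∙ A c) , a · w , ^ω-resp-≈ AC≈x D≈y (^ω-∙ A≈a p) ,
              a , w , a∈U , q , ≋-refl) })
      (λ { (c , w , p , C , D , q , r) AC≈x D≈y →
        αω-step (𝒞-resp-≈ AC≈x D≈y (𝒞-∙ A c) , a · w , ^ω-resp-≈ AC≈x D≈y (^ω-∙ A≈a p) ,
                 A ∙ C , D , q ≈.refl ≈.refl , ^ω-∙ A≈a r) })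
      p AC≈x D≈y

Limit-constant : ∀ {A : Set} {s : ℕ → List A} {u w} → (∀ n → s n ≡ u) → Limit s w → w ≋ fin u
Limit-constant {s = s} {u} {fin x} eq lim with Limit.least lim x (≼-reflexive refl)
... | n , x≼ = fin (Pointwise-≡⇒≡ (Prefixₚ.antisym (λ p _ → p)
        (subst (x ≼_) (eq n) x≼) (subst (_≼ x) (eq 0) (Limit.upper lim 0))))
Limit-constant {s = s} {u} {inf x} eq lim with Limit.least lim _ (applyUpTo-⊑ x (suc (length u)))
... | n , x≼ = ⊥-elim (ℕₚ.<-irrefl refl (subst (_≤ length u) (cong suc (length-applyUpTo _ _))
        (length-mono (subst (_ ≼_) (eq n) x≼))))

-- Saturation and factorisation of infinite words

module Saturation {s : ℕ} (𝔄 : Automaton s) where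

  open Automaton 𝔄
  open Abstraction 𝔄
  open Classes 𝔄
  open Equivalence using (to)

  []≈⇒≡[] : ∀ {u} → [] ≈ u → u ≡ []
  []≈⇒≡[] ε≈ε = refl

  ∷≈⇒∷ : ∀ {a D u} → a ∷ D ≈ u → ∃₂ λ b v → b ∷ v ≡ u
  ∷≈⇒∷ (~⇒≈ _) = _ , _ , refl

  ∷≈⇒≢[] : ∀ {a D u} → a ∷ D ≈ u → u ≢ []
  ∷≈⇒≢[] (~⇒≈ _) ()

  concatTo-[] : ∀ {d : ℕ → Q} → (∀ i → [] ≈ d i) → ∀ n → concatTo d n ≡ []
  concatTo-[] eq zero    = refl
  concatTo-[] {d} eq (suc n) rewrite []≈⇒≡[] (eq 0) = concatTo-[] (eq ∘ suc) n

  -- The class of `D` decides the kind of limit. Only the empty word is equivalent to the empty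
  -- word, so either all factors vanish and `u` is the limit, or each contributes a letter and the
  -- limit is infinite.
  limit-exists : ∀ {D} u {d : ℕ → Q} → (∀ n → D ≈ d n) → ∃ (Limit (λ n → u ++ concatTo d n))
  limit-exists {[]} u {d} D≈d = fin u , record
    { upper = λ n → ≼-reflexive (eq n)
    ; least = λ z z≼u → 0 , subst (z ≼_) (sym (eq 0)) z≼u
    }
    where
    eq : ∀ n → u ++ concatTo d n ≡ u
    eq n = trans (cong (u ++_) (concatTo-[] D≈d n)) (++-identityʳ u)
  limit-exists {a ∷ D} u {d} D≈d
    with concatTo-Limit (λ i → proj₁ (∷≈⇒∷ (D≈d i))) (λ i → proj₁ (proj₂ (∷≈⇒∷ (D≈d i))))
  ... | x , lim = u · inf x , Limit-++⁺ u (Limit-resp-≗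
          (λ n → cong concat (applyUpTo-cong (λ i → proj₂ (proj₂ (∷≈⇒∷ (D≈d i)))) n)) lim)

  module _ (x : ℕ → Fin s) where

    -- Pieces of `x`, and below runs over them, carry both end positions as indices, so that they
    -- compose without arithmetic on lengths.
    data Factor : ℕ → List (Fin s) → ℕ → Set where
      []  : ∀ {n} → Factor n [] n
      _∷_ : ∀ {n a w n′} → x n ≡ a → Factor (suc n) w n′ → Factor n (a ∷ w) n′

    data Run : ℕ → Fin states → ℕ → Fin states → Set where
      []  : ∀ {n p} → Run n p n p
      _∷_ : ∀ {n p r n′ q} → r ∈ˢ δ p (x n) → Run (suc n) r n′ q → Run n p n′ q

  module _ {x : ℕ → Fin s} where

    Factor-++⁻ : ∀ u {v n n′} → Factor x n (u ++ v) n′ → ∃ λ k → Factor x n u k × Factor x k v n′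
    Factor-++⁻ []      f        = _ , [] , f
    Factor-++⁻ (a ∷ u) (eq ∷ f) with Factor-++⁻ u f
    ... | k , g , h = k , eq ∷ g , h

    Factor-length : ∀ {u n n′} → Factor x n u n′ → n′ ≡ n + length u
    Factor-length []      = sym (ℕₚ.+-identityʳ _)
    Factor-length (_ ∷ f) = trans (Factor-length f) (sym (ℕₚ.+-suc _ _))

    Factor-≤ : ∀ {u n n′} → Factor x n u n′ → n ≤ n′
    Factor-≤ []      = ≤-refl
    Factor-≤ (_ ∷ f) = ≤-trans (ℕₚ.n≤1+n _) (Factor-≤ f)

    ⊑⇒Factor : ∀ u k → u ≡ applyUpTo (λ i → x (k + i)) (length u) → Factor x k u (k + length u)
    ⊑⇒Factor []      k eq = subst (Factor x k []) (sym (ℕₚ.+-identityʳ k)) []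
    ⊑⇒Factor (a ∷ u) k eq =
      trans (cong x (sym (ℕₚ.+-identityʳ k))) (sym (∷-injectiveˡ eq)) ∷
      subst (Factor x (suc k) u) (sym (ℕₚ.+-suc k (length u)))
        (⊑⇒Factor u (suc k) (trans (∷-injectiveʳ eq)
          (applyUpTo-cong (λ i → cong x (ℕₚ.+-suc k i)) (length u))))

    ++-⊑⇒Factor : ∀ u {v} → u ++ v ⊑ inf x → Factor x (length u) v (length (u ++ v))
    ++-⊑⇒Factor u {v} p with Factor-++⁻ u (⊑⇒Factor (u ++ v) 0 p)
    ... | k , f , g = subst (λ k → Factor x k v (length (u ++ v))) (Factor-length f) g

    Run-++ : ∀ {n p k r n′ q} → Run x n p k r → Run x k r n′ q → Run x n p n′ q
    Run-++ []      S = S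
    Run-++ (e ∷ R) S = e ∷ Run-++ R S

    Run-≤ : ∀ {n p n′ q} → Run x n p n′ q → n ≤ n′
    Run-≤ []      = ≤-refl
    Run-≤ (_ ∷ R) = ≤-trans (ℕₚ.n≤1+n _) (Run-≤ R)

    ⟿⇒Run : ∀ {w n n′ p q} → Factor x n w n′ → p ⟿[ w ] q → Run x n p n′ q
    ⟿⇒Run []         refl          = []
    ⟿⇒Run (refl ∷ f) (r , r∈δ , π) = r∈δ ∷ ⟿⇒Run f π

    module _ {ρ : ℕ → Fin states} (ρ-step : ∀ i → ρ (suc i) ∈ˢ δ (ρ i) (x i)) where

      run⇒⟿ : ∀ {w n n′} → Factor x n w n′ → ρ n ⟿[ w ] ρ n′
      run⇒⟿ []         = refl
      run⇒⟿ (refl ∷ f) = ρ (suc _) , ρ-step _ , run⇒⟿ f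

      run⇒⟿F : ∀ {w n n′ k} → Factor x n w n′ → n ≤ k → k ≤ n′ → ρ k ∈ˢ F → ρ n ⟿F[ w ] ρ n′
      run⇒⟿F {w} {n} f n≤k k≤n′ k∈F with ℕₚ.m≤n⇒m<n∨m≡n n≤k
      ... | inj₂ refl = [] , w , ρ n , refl , k∈F , refl , run⇒⟿ f
      run⇒⟿F []         n≤k k≤n k∈F | inj₁ n<k = ⊥-elim (ℕₚ.<⇒≱ n<k k≤n)
      run⇒⟿F (refl ∷ f) _   k≤n k∈F | inj₁ n<k with run⇒⟿F f n<k k≤n k∈F
      ... | u , v , r , refl , r∈F , π₁ , π₂ =
        _ ∷ u , v , r , refl , r∈F , (_ , ρ-step _ , π₁) , π₂

    module _ {Acc : ℕ → Fin states → Set} (Acc⇒F : ∀ {n q} → Acc n q → q ∈ˢ F)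
      (advance : ∀ {n q} → Acc n q → ∃₂ λ n′ q′ → n < n′ × Run x n q n′ q′ × Acc n′ q′) where

      private
        Cursor : ℕ → Fin states → Set
        Cursor n p = ∃₂ λ n′ q → Run x n p n′ q × Acc n′ q

        next : ∀ {n} → ∃ (Cursor n) → ∃ (Cursor (suc n))
        edge : ∀ {n} (c : ∃ (Cursor n)) → proj₁ (next c) ∈ˢ δ (proj₁ c) (x n)
        next (p , n′ , q , e ∷ R , acc) = _ , n′ , q , R , acc
        next (p , n , p , [] , acc) with advance acc
        ... | n′ , q , n<n , []    , _    = ⊥-elim (ℕₚ.<-irrefl refl n<n)
        ... | n′ , q , _   , e ∷ R , acc′ = _ , n′ , q , R , acc′
        edge (p , n′ , q , e ∷ R , acc) = e
        edge (p , n , p , [] , acc) with advance acc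
        ... | n′ , q , n<n , []    , _    = ⊥-elim (ℕₚ.<-irrefl refl n<n)
        ... | n′ , q , _   , e ∷ R , acc′ = e

      -- A cursor holds the pending run to the next accepting state. `next` walks one edge of it and
      -- asks `advance` for a new run when none is left; `n < n′` keeps that run nonempty. A pending
      -- run is finite, so `visit` reaches its accepting end.
      accept : ∀ {n q} → Run x 0 q₀ n q → Acc n q → L (inf x)
      accept R acc = proj₁ ∘ cursor , refl , (λ i → edge (cursor i)) ,
        λ n → visit (proj₁ (proj₂ (proj₂ (proj₂ (cursor n))))) refl
        where
        cursor : ∀ n → ∃ (Cursor n)
        cursor zero    = q₀ , _ , _ , R , acc
        cursor (suc n) = next (cursor n)
        visit : ∀ {n p n′ q acc} (S : Run x n p n′ q) → cursor n ≡ (p , n′ , q , S , acc) →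
          ∃ λ k → n ≤ k × proj₁ (cursor k) ∈ˢ F
        visit {n} {acc = acc} [] eq = n , ≤-refl , subst (_∈ˢ F) (sym (cong proj₁ eq)) (Acc⇒F acc)
        visit (e ∷ S) eq with visit S (cong next eq)
        ... | k , l , p = k , <⇒≤ l , p

    -- From an accepting state the next one is sought beyond the following
    -- node r j, so that the run in between is never empty.
    splice : {t : ℕ → ℕ} {r : ℕ → Fin states} → Increasing t →
      Run x 0 q₀ (t 0) (r 0) →
      (∀ i → Run x (t i) (r i) (t (suc i)) (r (suc i))) →
      InfinitelyOften (λ i → ∃₂ λ n q →
        q ∈ˢ F × Run x (t i) (r i) n q × Run x n q (t (suc i)) (r (suc i))) →
      L (inf x)
    splice {t} {r} inc start edge io with io 0
    ... | i , _ , n , q , q∈F , R , S =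
      accept {Acc} proj₁ advance (Run-++ start (Run-++ (spine z≤n) R)) (q∈F , suc i , S)
      where
      Acc : ℕ → Fin states → Set
      Acc n q = q ∈ˢ F × ∃ λ i → Run x n q (t i) (r i)
      spine′ : ∀ i k → Run x (t i) (r i) (t (k + i)) (r (k + i))
      spine′ i zero    = []
      spine′ i (suc k) = Run-++ (spine′ i k) (edge (k + i))
      spine : ∀ {i j} → i ≤ j → Run x (t i) (r i) (t j) (r j)
      spine {i} {j} i≤j = subst (λ k → Run x (t i) (r i) (t k) (r k)) (ℕₚ.m∸n+n≡m i≤j) (spine′ i (j ∸ i))
      advance : ∀ {n q} → Acc n q → ∃₂ λ n′ q′ → n < n′ × Run x n q n′ q′ × Acc n′ q′
      advance (_ , i , R) with io (suc i)
      ... | j , i<j , n′ , q′ , q′∈F , S , S′ = n′ , q′ ,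
        ≤-trans (s≤s (Run-≤ R)) (≤-trans (increasing-mono inc i<j) (Run-≤ S)) ,
        Run-++ R (Run-++ (spine (<⇒≤ i<j)) S) , q′∈F , suc j , S′

  -- As `t` is increasing, `t (k + n)` is at least `k`, so the block around `k` is found by
  -- searching downward from index `k + n`.
  locate : ∀ {t} → Increasing t → ∀ {n k} → t n ≤ k → ∃ λ i → n ≤ i × t i ≤ k × k ≤ t (suc i)
  locate {t} inc {n} {k} t≤k = go k (≤-trans (ℕₚ.m≤m+n k n) (increasing-≤ inc (k + n)))
    where
    go : ∀ j → k ≤ t (j + n) → ∃ λ i → n ≤ i × t i ≤ k × k ≤ t (suc i)
    go zero    k≤ = n , ≤-refl , t≤k , ≤-trans k≤ (<⇒≤ (inc n))
    go (suc j) k≤ with ≤-total k (t (j + n))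
    ... | inj₁ k≤′ = go j k≤′
    ... | inj₂ ≤k  = j + n , ℕₚ.m≤n+m n j , ≤k , k≤

  module Positions {u : Q} {d : ℕ → Q} {x : ℕ → Fin s}
    (d≢[] : ∀ n → d n ≢ []) (lim : Limit (λ n → u ++ concatTo d n) (inf x)) where

    position : ℕ → ℕ
    position i = length (u ++ concatTo d i)

    start : Factor x 0 u (position 0)
    start = subst (λ v → Factor x 0 u (length v)) (sym (++-identityʳ u))
      (++-⊑⇒Factor [] (≼-⊑-trans {w = inf x} (≼-++ u) (Limit.upper lim 0)))

    factor : ∀ i → Factor x (position i) (d i) (position (suc i))
    factor i = subst (λ v → Factor x (position i) (d i) (length v)) (sym step)
      (++-⊑⇒Factor (u ++ concatTo d i) (subst (_⊑ inf x) step (Limit.upper lim (suc i))))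
      where
      step : u ++ concatTo d (suc i) ≡ (u ++ concatTo d i) ++ d i
      step = trans (cong (u ++_) (concatTo-suc d i)) (sym (++-assoc u _ _))

    position-inc : Increasing position
    position-inc i with d i | d≢[] i | factor i
    ... | []    | ≢[] | _     = ⊥-elim (≢[] refl)
    ... | _ ∷ _ | _   | _ ∷ f = Factor-≤ f

  saturated-fin : ∀ {u v} → u ≈ v → L (fin u) → L (fin v)
  saturated-fin u≈v (q , q∈F , π) = q , q∈F , to (proj₁ (≈⇒~ u≈v _ _)) π

  L-resp-≋ : ∀ {w w′} → w ≋ w′ → L w → L w′
  L-resp-≋ (fin refl) p = p
  L-resp-≋ {inf x} {inf y} (inf eq) (ρ , ρ0 , step , io) =
    ρ , ρ0 , (λ i → subst (λ a → ρ (suc i) ∈ˢ δ (ρ i) a) (eq i) (step i)) , io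

  ¬Limit-fin : ∀ {a D u} {d : ℕ → Q} {v} → (∀ n → a ∷ D ≈ d n) →
    ¬ Limit (λ n → u ++ concatTo d n) (fin v)
  ¬Limit-fin {u = u} {d} {v} D≈d lim = ℕₚ.<-irrefl refl (begin
    suc (length v)                                     ≤⟨ concatTo-long d (∷≈⇒≢[] ∘ D≈d) _ ⟩
    length (concatTo d (suc (length v)))               ≤⟨ ℕₚ.m≤n+m _ (length u) ⟩
    length u + length (concatTo d (suc (length v)))    ≡⟨ length-++ u ⟨
    length (u ++ concatTo d (suc (length v)))          ≤⟨ length-mono (Limit.upper lim (suc (length v))) ⟩
    length v                                           ∎)
    where open ℕₚ.≤-Reasoning

  -- Büchi's saturation argument. An accepting run over one word is cut at its block boundaries; `~`
  -- gives each corresponding block of the other word a path between the same states, passing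
  -- through `F` whenever the original piece does. For the empty `D` both words are finite members
  -- of the class `C`.
  saturated : ∀ {C D w w′} → (C [ D ]^ω) w → (C [ D ]^ω) w′ → L w → L w′
  saturated w∈ w′∈ with ^ω-elim w∈ | ^ω-elim w′∈
  saturated {D = []} _ _ | u , d , C≈u , D≈d , lim | u′ , d′ , C≈u′ , D≈d′ , lim′ =
    L-resp-≋ (≋-sym (w≋ D≈d′ lim′)) ∘
    saturated-fin (≈.trans (≈.sym C≈u) C≈u′) ∘
    L-resp-≋ (w≋ D≈d lim)
    where
    w≋ : ∀ {u d w} → (∀ n → [] ≈ d n) → Limit (λ n → u ++ concatTo d n) w → w ≋ fin u
    w≋ {u} D≈d = Limit-constant λ n → trans (cong (u ++_) (concatTo-[] D≈d n)) (++-identityʳ u)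
  saturated {D = _ ∷ _} {fin _} _ _ | u , d , C≈u , D≈d , lim | _ = ⊥-elim (¬Limit-fin {u = u} D≈d lim)
  saturated {D = _ ∷ _} {inf _} {fin _} _ _ | _ | u , d , C≈u , D≈d , lim = ⊥-elim (¬Limit-fin {u = u} D≈d lim)
  saturated {D = _ ∷ _} {inf x} {inf y} _ _ | u , d , C≈u , D≈d , lim | u′ , d′ , C≈u′ , D≈d′ , lim′ =
    transfer
    where
    module X = Positions (∷≈⇒≢[] ∘ D≈d) lim
    module Y = Positions (∷≈⇒≢[] ∘ D≈d′) lim′
    d~d′ : ∀ i → d i ~ d′ i
    d~d′ i = ≈⇒~ (≈.trans (≈.sym (D≈d i)) (D≈d′ i))
    transfer : L (inf x) → L (inf y)
    transfer (ρ , refl , step , io) = splice Y.position-inc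
      (⟿⇒Run Y.start (to (proj₁ (≈⇒~ (≈.trans (≈.sym C≈u) C≈u′) _ _)) (run⇒⟿ step X.start)))
      (λ i → ⟿⇒Run (Y.factor i) (to (proj₁ (d~d′ i _ _)) (run⇒⟿ step (X.factor i))))
      io′
      where
      io′ : InfinitelyOften _
      io′ n with io (X.position n)
      ... | k , n≤k , k∈F with locate X.position-inc n≤k
      ... | i , n≤i , i≤k , k≤i
        -- Only the index of the block is preserved: the final state `q` met in the other word and
        -- its position inside the block may be different.
        with to (proj₂ (d~d′ i _ _)) (run⇒⟿F step (X.factor i) i≤k k≤i k∈F)
      ... | a , b , q , eq , q∈F , π₁ , π₂
        with Factor-++⁻ a (subst (λ w → Factor y _ w _) eq (Y.factor i))
      ... | n′ , f , g = i , n≤i , n′ , q , q∈F , ⟿⇒Run f π₁ , ⟿⇒Run g π₂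

  -- Each stage adds only pairs whose language shares a word with a language already inside `L`;
  -- `saturated` spreads this one word to the whole language.
  γω-αω-⊆L : ∀ {V : Pred (Word (Fin s)) 0ℓ} → V ⊆ L → γω (αω V) ⊆ L
  γω-αω-⊆L {V} V⊆L {w} (C , D , p , w∈) =
    αω-least {V} {λ { (C , D) → ∀ {w} → (C [ D ]^ω) w → L w }}
      (λ { (_ , v , v∈ , v∈V) w∈ → saturated v∈ w∈ (V⊆L v∈V) })
      (λ { (_ , v , v∈ , C , D , q , v∈′) w∈ → saturated v∈ w∈ (q v∈′) })
      p w∈

  module Factorisation (em : ExcludedMiddle 0ℓ) where

    open Classical em

    private
      bit : ∀ {P : Set} → Dec P → Fin 2
      bit (yes _) = zero
      bit (no _)  = suc zero

      bit-injective : ∀ {P P′ : Set} (d : Dec P) (d′ : Dec P′) → bit d ≡ bit d′ → P ⇔ P′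
      bit-injective (yes p) (yes p′) _ = mk⇔ (λ _ → p′) (λ _ → p)
      bit-injective (no ¬p) (no ¬p′) _ = mk⇔ (⊥-elim ∘ ¬p) (⊥-elim ∘ ¬p′)

      empty : Q → Fin 2
      empty []      = zero
      empty (_ ∷ _) = suc zero

      table : Q → Fin states → Fin states → Fin (2 * 2)
      table w p q = combine (bit (em {p ⟿[ w ] q})) (bit (em {p ⟿F[ w ] q}))

    abstract

      -- One bit tells whether the word is empty; for every pair of states two further bits record
      -- `⟿` and `⟿F`. Equal codes therefore mean `≈`, which makes the classes a finite set of
      -- colours.
      class : Q → Fin (2 * ((2 * 2) ^ states) ^ states)
      class w = combine (empty w) (funToFin λ p → funToFin (table w p))

      class-injective : ∀ {w u} → class w ≡ class u → w ≈ u
      class-injective {w} {u} eq with combine-injective (empty w) _ (empty u) _ eq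
      ... | eq₁ , eq₂ = cases w u eq₁ w~u
        where
        funToFin-injective : ∀ {m n} {f g : Fin m → Fin n} → funToFin f ≡ funToFin g → f ≗ g
        funToFin-injective {f = f} {g} eq i = trans (sym (finToFun-funToFin f i))
          (trans (cong (λ z → finToFun z i) eq) (finToFun-funToFin g i))
        w~u : w ~ u
        w~u p q with combine-injective _ _ _ _
                       (funToFin-injective {f = table w p}
                       (funToFin-injective {f = λ p → funToFin (table w p)} eq₂ p) q)
        ... | b , b′ = bit-injective em em b , bit-injective em em b′
        cases : ∀ w u → empty w ≡ empty u → w ~ u → w ≈ u
        cases []      []      _ _ = ε≈ε
        cases (_ ∷ _) (_ ∷ _) _ e = ~⇒≈ e

      -- Ramsey's theorem with the class of `segment d i j` as the colour of `i < j`. On the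
      -- homogeneous set a segment across two gaps has the same class as each of its halves, whence
      -- `D` is idempotent.
      factorise : (d : ℕ → Q) → ∃₂ λ φ D → Increasing φ × 𝒞 (concatTo d (φ 0) , D) ×
        ∀ i → D ≈ segment d (φ i) (φ (suc i))
      factorise d with ramsey (λ i j → class (segment d i j))
      -- The first cut is at `ψ 1`, not `ψ 0`: the initial piece then ends in a segment of class `D`
      -- and absorbs a further `D`.
      ... | ψ , k , inc , mono = ψ ∘ suc , D , inc ∘ suc , (CD≈C , DD≈D) , λ i → D≈ (s≤s z≤n) ≤-refl
        where
        D : Q
        D = segment d (ψ 0) (ψ 1)
        D≈ : ∀ {i j} → 0 < j → i < j → D ≈ segment d (ψ i) (ψ j)
        D≈ 0<j i<j = class-injective (trans (mono ≤-refl) (sym (mono i<j)))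
        ψ01 : ψ 0 ≤ ψ 1
        ψ01 = <⇒≤ (inc 0)
        ψ12 : ψ 1 ≤ ψ 2
        ψ12 = <⇒≤ (inc 1)
        DD≈D : D ∙ D ≈ D
        DD≈D = ≈.trans (≈.∙-cong (≈.refl {D}) (D≈ (s≤s z≤n) (≤-refl {2})))
          (≈.trans (≈.reflexive (sym (segment-++ d ψ01 ψ12))) (≈.sym (D≈ {0} {2} (s≤s z≤n) (s≤s z≤n))))
        CD≈C : concatTo d (ψ 1) ∙ D ≈ concatTo d (ψ 1)
        CD≈C = ≈.trans
          (≈.reflexive (trans (cong (_++ D) (concatTo-segment d ψ01)) (++-assoc (concatTo d (ψ 0)) D D)))
          (≈.trans (≈.∙-cong (≈.refl {concatTo d (ψ 0)}) DD≈D) (≈.reflexive (sym (concatTo-segment d ψ01))))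

    -- Cut points found for `d` serve every factorwise equivalent sequence, so two products with
    -- equivalent factors fall into the language of one common pair.
    factorise-∈ : ∀ {d d′ : ℕ → Q} {φ D w} → Increasing φ →
      (∀ i → D ≈ segment d (φ i) (φ (suc i))) → (∀ i → d i ≈ d′ i) →
      Limit (concatTo d′) w → (concatTo d (φ 0) [ D ]^ω) w
    factorise-∈ {d} {d′} {φ} inc D≈ d≈d′ lim = ^ω-intro {t = concatTo d′ ∘ φ}
      (concatTo-cong d≈d′ (φ 0))
      (λ n → concatTo-segment d′ (<⇒≤ (inc n)))
      (λ n → ≈.trans (D≈ n) (segment-cong d≈d′ (φ n) (φ (suc n))))
      (Limit-increasing φ inc (concatTo-mono d′) lim)

    ^ω⊆𝔤-αω : ∀ {U : Pred Q 0ℓ} → U ^ω ⊆ 𝔤 (αω (U ^ω))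
    ^ω⊆𝔤-αω {U} (d , d∈U , lim) with factorise d
    ... | φ , D , inc , c , D≈ = _ , D , 𝔣⊆αω (c , _ , w∈ , d , d∈U , lim) , w∈
      where w∈ = factorise-∈ inc D≈ (λ _ → ≈.refl) lim

    -- The factors may be empty or not in any pattern. After regrouping they all have one class, and
    -- `limit-exists` applies.
    ^ω-limit : ∀ (d : ℕ → Q) → ∃ (Limit (concatTo d))
    ^ω-limit d with factorise d
    ... | φ , D , inc , _ , D≈ with limit-exists (concatTo d (φ 0)) D≈
    ... | w , lim = w , Limit-cofinal
      (λ n → n , ≼-trans (concatTo-mono d (increasing-≤ inc n)) (≼-reflexive (eq n)))
      (λ n → φ n , ≼-reflexive (sym (eq n))) lim
      where
      eq : ∀ n → concatTo d (φ n) ≡ concatTo d (φ 0) ++ concatTo (λ i → segment d (φ i) (φ (suc i))) n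
      eq = concatTo-unique _ λ n → concatTo-segment d (<⇒≤ (inc n))

    -- Replacing each factor of `w` by an equivalent one from `U` gives `w′` in `U ^ω`, and both
    -- words lie in the language of the pair found by `factorise`. That pair belongs to `𝔣 (U ^ω)`,
    -- so the given pair, which contains `w`, follows by one step.
    αω-^ω : ∀ {𝒜 U : Pred Q 0ℓ} → 𝒜 ⊆ α* U → αω (γ* 𝒜 ^ω) ⊆ αω (U ^ω)
    αω-^ω {𝒜} {U} 𝒜⊆ = αω-least base αω-step
      where
      represent : ∀ {w} → γ* 𝒜 w → ∃ λ u → w ≈ u × U u
      represent (C , C∈ , C≈w) with 𝒜⊆ C∈
      ... | u , C≈u , u∈ = u , ≈.trans (≈.sym C≈w) C≈u , u∈
      base : 𝔣 (γ* 𝒜 ^ω) ⊆ αω (U ^ω)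
      base (c , w , w∈ , d , d∈ , lim) with factorise d | ^ω-limit (proj₁ ∘ represent ∘ d∈)
      ... | φ , D , inc , c′ , D≈ | w′ , lim′ =
        αω-step (c , w , w∈ , _ , D , 𝔣⊆αω (c′ , w′ ,
          factorise-∈ inc D≈ (proj₁ ∘ proj₂ ∘ represent ∘ d∈) lim′ ,
          (proj₁ ∘ represent ∘ d∈) , (proj₂ ∘ proj₂ ∘ represent ∘ d∈) , lim′) ,
          factorise-∈ inc D≈ (λ _ → ≈.refl) lim)

≼-++⁻ : ∀ {A : Set} {u} (v : List A) {w} → u ≼ v ++ w → u ≼ v ⊎ ∃ λ z → u ≡ v ++ z × z ≼ w
≼-++⁻ []      p          = inj₂ (_ , refl , p)
≼-++⁻ (a ∷ v) []         = inj₁ []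
≼-++⁻ (a ∷ v) (refl ∷ p) with ≼-++⁻ v p
... | inj₁ q              = inj₁ (refl ∷ q)
... | inj₂ (z , refl , q) = inj₂ (z , refl , q)

prepend-applyUpTo : ∀ {A : Set} (x : ℕ → A) l → prepend (applyUpTo x l) (λ n → x (l + n)) ≗ x
prepend-applyUpTo x zero    n       = refl
prepend-applyUpTo x (suc l) zero    = refl
prepend-applyUpTo x (suc l) (suc n) = prepend-applyUpTo (x ∘ suc) l n

snoc≢[] : ∀ {A : Set} (u : List A) {a} → u ++ [ a ] ≢ []
snoc≢[] []      ()
snoc≢[] (_ ∷ _) ()

x∉p-x : ∀ {n} (p : Subset n) x → x ∉ˢ p - x
x∉p-x (outside ∷ p) zero    ()
x∉p-x (inside ∷ p)  zero    ()
x∉p-x (_ ∷ p)       (suc x) (there x∈) = x∉p-x p x x∈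

-- Traces as paths of tail calls

module Behaviour {s m : ℕ} (P : Program s m) where

  open Semantics P

  infix 4 _⇑∞_

  _⇑∞_ : Expr s m → (ℕ → Event) → Set
  e ⇑∞ x = ∀ n → e ⇑ applyUpTo x n

  θ-++ : ∀ (u : List Event) {v} → θ (u ++ v) ≡ θ u ++ θ v
  θ-++ u = catMaybes-++ u _

  θ-mono : ∀ {u v : List Event} → u ≼ v → θ u ≼ θ v
  θ-mono {u} p with ≼⇒++ p
  ... | z , refl = subst (θ u ≼_) (sym (θ-++ u)) (≼-++ (θ u))

  θ-concatTo : ∀ {d : ℕ → List Event} {d′} → (∀ i → θ (d i) ≡ d′ i) →
    ∀ n → θ (concatTo d n) ≡ concatTo d′ n
  θ-concatTo         eq zero    = refl
  θ-concatTo {d} eq (suc n) = trans (θ-++ (d 0)) (cong₂ _++_ (eq 0) (θ-concatTo (eq ∘ suc) n))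

  module _ {x : ℕ → Event} {c : ℕ → List Event}
    (c⊑x : ∀ n → c n ⊑ inf x) (long : ∀ n → n ≤ length (c n)) where

    applyUpTo-≼ : ∀ n → applyUpTo x n ≼ c n
    applyUpTo-≼ n = ⊑-linear (applyUpTo-⊑ x n) (c⊑x n)
      (subst (_≤ length (c n)) (sym (length-applyUpTo x n)) (long n))

    Limit-θ⁺ : ∀ {w} → Limit (λ n → θ (applyUpTo x n)) w → Limit (θ ∘ c) w
    Limit-θ⁺ = Limit-cofinal
      (λ n → length (c n) , ≼-reflexive (cong θ (c⊑x n))) (λ n → n , θ-mono (applyUpTo-≼ n))

    Limit-θ⁻ : ∀ {w} → Limit (θ ∘ c) w → Limit (λ n → θ (applyUpTo x n)) w
    Limit-θ⁻ = Limit-cofinal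
      (λ n → n , θ-mono (applyUpTo-≼ n)) (λ n → length (c n) , ≼-reflexive (cong θ (c⊑x n)))

  ⇓⇒⇑ : ∀ {e w u} → e ⇓ w → u ≼ w → e ⇑ u
  ⇓⇒⇑ ⇓-o        []            = ⇑-ε
  ⇓⇒⇑ ⇓-o        (refl ∷ [])   = ⇑-o
  ⇓⇒⇑ (⇓-call p) []            = ⇑-ε
  ⇓⇒⇑ (⇓-call p) (refl ∷ q)    = ⇑-call (⇓⇒⇑ p q)
  ⇓⇒⇑ (⇓-⨾ {w = w} p p′) q with ≼-++⁻ w q
  ... | inj₁ r              = ⇑-⨾₁ (⇓⇒⇑ p r)
  ... | inj₂ (z , refl , r) = ⇑-⨾₂ p (⇓⇒⇑ p′ r)
  ⇓⇒⇑ (⇓-⁇₁ p)   q     = ⇑-⁇₁ (⇓⇒⇑ p q)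
  ⇓⇒⇑ (⇓-⁇₂ p)   q     = ⇑-⁇₂ (⇓⇒⇑ p q)

  ⇑-≼ : ∀ {e w u} → e ⇑ w → u ≼ w → e ⇑ u
  ⇑-≼ ⇑-ε        []            = ⇑-ε
  ⇑-≼ ⇑-o        []            = ⇑-ε
  ⇑-≼ ⇑-o        (refl ∷ [])   = ⇑-o
  ⇑-≼ (⇑-call p) []            = ⇑-ε
  ⇑-≼ (⇑-call p) (refl ∷ q)    = ⇑-call (⇑-≼ p q)
  ⇑-≼ (⇑-⨾₂ {w = w} p p′) q with ≼-++⁻ w q
  ... | inj₁ r                = ⇑-⨾₁ (⇓⇒⇑ p r)
  ... | inj₂ (z , refl , r)   = ⇑-⨾₂ p (⇑-≼ p′ r)
  ⇑-≼ (⇑-⨾₁ p)   q             = ⇑-⨾₁ (⇑-≼ p q)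
  ⇑-≼ (⇑-⁇₁ p)   q             = ⇑-⁇₁ (⇑-≼ p q)
  ⇑-≼ (⇑-⁇₂ p)   q             = ⇑-⁇₂ (⇑-≼ p q)

  ↑-prepend : ∀ {e e′ v} w → (∀ {u} → e′ ⇑ u → e ⇑ w ++ u) → e′ ↑ v → e ↑ (θ w · v)
  ↑-prepend {e} w ctx (x , lim , run) = prepend w x ,
    Limit-cofinal
      (λ n → n , subst (θ (applyUpTo (prepend w x) n) ≼_) (trans (cong θ (applyUpTo-prepend w x n)) (θ-++ w))
                   (θ-mono (applyUpTo-mono _ (ℕₚ.m≤n+m n (length w)))))
      (λ n → length w + n , ≼-reflexive (sym (trans (cong θ (applyUpTo-prepend w x n)) (θ-++ w))))
      (Limit-++⁺ (θ w) lim) ,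
    λ n → ⇑-≼ (subst (e ⇑_) (sym (applyUpTo-prepend w x n)) (ctx (run n)))
              (applyUpTo-mono _ (ℕₚ.m≤n+m n (length w)))

  ↑-resp-≋ : ∀ {e w w′} → w ≋ w′ → e ↑ w → e ↑ w′
  ↑-resp-≋ eq (x , lim , run) = x , Limit-resp-≋ eq lim , run

  ↑-mono : ∀ {e e′} → (∀ {u} → e ⇑ u → e′ ⇑ u) → (e ↑_) ⊆ (e′ ↑_)
  ↑-mono sub (x , lim , run) = x , lim , λ n → sub (run n)

  -- The semantic upper bound for paths of tail calls: after `w`, the expression inherits every
  -- partial trace of `call g`. Stated through its effect on `⇑`, it composes like functions.
  Context : Expr s m → List Event → Fin m → Set
  Context e w g = ∀ {u} → call g ⇑ u → e ⇑ w ++ u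

  contexts : Expr s m → Fin m → Pred (List (Fin s)) 0ℓ
  contexts e g z = ∃ λ w → z ≡ θ w × Context e w g

  contexts-mono : ∀ {e e′ g} → (∀ {u} → e ⇑ u → e′ ⇑ u) → contexts e g ⊆ contexts e′ g
  contexts-mono sub (w , eq , ctx) = w , eq , λ p → sub (ctx p)

  contexts-⊙ : ∀ {e g} → contexts e g ⊙ (call g ↑_) ⊆ (e ↑_)
  contexts-⊙ (_ , v , (w , refl , ctx) , g↑ , eq) = ↑-resp-≋ eq (↑-prepend w ctx g↑)

  call-↑ : ∀ {f} → (P f ↑_) ⊆ (call f ↑_)
  call-↑ p = ↑-resp-≋ ([]-· _) (↑-prepend [ ✓ ] ⇑-call p)

  contexts-⋆ : ∀ {f} → contexts (P f) f ⋆ ⊆ contexts (call f) f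
  contexts-⋆ {f} (ws , ps , refl) = go ps
    where
    go : ∀ {ws} → All (contexts (P f) f) ws → contexts (call f) f (concat ws)
    go []                          = [] , refl , id
    go ((w , refl , ctx) ∷ ps) with go ps
    ... | w′ , eq , ctx′ = ✓ ∷ w ++ w′ , trans (cong (θ w ++_) eq) (sym (θ-++ w)) ,
      λ {u} p → ⇑-call (subst (P f ⇑_) (sym (++-assoc w w′ u)) (ctx (ctx′ p)))

  -- Every round opens with the ✓ of unfolding `f`. The unerased trace is thus infinite even when
  -- the visible factors are eventually empty, and erasing it yields the given limit.
  contexts-^ω : ∀ {f} → contexts (P f) f ^ω ⊆ (call f ↑_)
  contexts-^ω {f} (d , ps , lim) with concatTo-Limit (λ _ → ✓) (proj₁ ∘ ps)
  ... | x , lim′ = x , Limit-θ⁻ (Limit.upper lim′) long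
      (Limit-resp-≗ (λ n → sym (θ-concatTo (sym ∘ proj₁ ∘ proj₂ ∘ ps) n)) lim) ,
      λ n → ⇑-≼ (run ps n) (applyUpTo-≼ (Limit.upper lim′) long n)
    where
    long : ∀ n → n ≤ length (concatTo (λ i → ✓ ∷ proj₁ (ps i)) n)
    long = concatTo-long _ λ _ ()
    run : ∀ {d : ℕ → List (Fin s)} (ps : ∀ i → contexts (P f) f (d i)) n →
      call f ⇑ concatTo (λ i → ✓ ∷ proj₁ (ps i)) n
    run ps zero    = ⇑-ε
    run ps (suc n) = ⇑-call (proj₂ (proj₂ (ps 0)) (run (ps ∘ suc) n))

  -- The call need not be syntactically last: in `e₁ ⨾ e₂` a call inside `e₁` counts, because a call
  -- that never returns leaves `e₂` unexecuted. The word ends just before the ✓ of the call.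
  data TailCall : Expr s m → List Event → Fin m → Set where
    call : ∀ {f} → TailCall (call f) [] f
    ⨾₁   : ∀ {e₁ e₂ w f} → TailCall e₁ w f → TailCall (e₁ ⨾ e₂) w f
    ⨾₂   : ∀ {e₁ e₂ w u f} → e₁ ⇓ w → TailCall e₂ u f → TailCall (e₁ ⨾ e₂) (w ++ u) f
    ⁇₁   : ∀ {e₁ e₂ w f} → TailCall e₁ w f → TailCall (e₁ ⁇ e₂) w f
    ⁇₂   : ∀ {e₁ e₂ w f} → TailCall e₂ w f → TailCall (e₁ ⁇ e₂) w f

  -- The path sets of Kleene's construction: inner vertices lie in `N`, and the path stops at the
  -- first vertex outside `N`.
  data Reach (N : Subset m) : Expr s m → List (Fin s) → Fin m → Set where
    stop : ∀ {e w g} → TailCall e w g → g ∉ˢ N → Reach N e (θ w) g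
    go   : ∀ {e w f u g} → TailCall e w f → f ∈ˢ N → Reach N (P f) u g → Reach N e (θ w ++ u) g

  record Path (N : Subset m) (f : Fin m) (w : Word (Fin s)) : Set where
    field
      proc   : ℕ → Fin m
      trace  : ℕ → List Event
      start  : proc 0 ≡ f
      within : ∀ i → proc i ∈ˢ N
      calls  : ∀ i → TailCall (P (proc i)) (trace i) (proc (suc i))
      limit  : Limit (concatTo (θ ∘ trace)) w

  Diverge : Subset m → Expr s m → Pred (Word (Fin s)) 0ℓ
  Diverge N e w = ∃₂ λ v f → ∃ λ w′ → TailCall e v f × Path N f w′ × θ v · w′ ≋ w

  ⨾-⇑⁻ : ∀ {e₁ e₂ z} → e₁ ⨾ e₂ ⇑ z → e₁ ⇑ z ⊎ ∃₂ λ w u → z ≡ w ++ u × e₁ ⇓ w × e₂ ⇑ u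
  ⨾-⇑⁻ ⇑-ε         = inj₁ ⇑-ε
  ⨾-⇑⁻ (⇑-⨾₂ p p′) = inj₂ (_ , _ , refl , p , p′)
  ⨾-⇑⁻ (⇑-⨾₁ p)    = inj₁ p

  ⁇-⇑⁻ : ∀ {e₁ e₂ z} → e₁ ⁇ e₂ ⇑ z → e₁ ⇑ z ⊎ e₂ ⇑ z
  ⁇-⇑⁻ ⇑-ε      = inj₁ ⇑-ε
  ⁇-⇑⁻ (⇑-⁇₁ p) = inj₁ p
  ⁇-⇑⁻ (⇑-⁇₂ p) = inj₂ p

  module _ (em : ExcludedMiddle 0ℓ) where

    open Classical em

    -- Structural recursion on `e` down to the call that never returns. `o a` has no trace of length
    -- 2. Once `e₁` fails at some length it fails at all greater ones, so long prefixes need `e₂`: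
    -- in a choice they come from it alone, in a sequence after a split position that still has to
    -- be made uniform.
    unfold : ∀ e {x} → e ⇑∞ x → ∃₂ λ w f → ∃ λ y →
      TailCall e w f × P f ⇑∞ y × (w ++ [ ✓ ]) · inf y ≋ inf x
    unfold (o a) run with run 2
    ... | ()
    unfold (call f) {x} run with x 0 in eq | run 1
    ... | just _ | ()
    ... | ✓      | _ = [] , f , x ∘ suc , call , (λ n → run′ n (run (suc n))) ,
      inf λ { zero → sym eq ; (suc n) → refl }
      where
      run′ : ∀ n → call f ⇑ x 0 ∷ applyUpTo (x ∘ suc) n → P f ⇑ applyUpTo (x ∘ suc) n
      run′ n p rewrite eq with p
      ... | ⇑-call q = q
    unfold (e₁ ⁇ e₂) {x} run with em {e₁ ⇑∞ x}
    ... | yes run₁ = let (w , f , y , t , r , eq) = unfold e₁ run₁ in w , f , y , ⁇₁ t , r , eq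
    ... | no ¬run₁ = let (w , f , y , t , r , eq) = unfold e₂ run₂ in w , f , y , ⁇₂ t , r , eq
      where
      run₂ : e₂ ⇑∞ x
      run₂ k with ¬∀⇒∃¬ ¬run₁
      ... | n , ¬e₁ with ⁇-⇑⁻ (run (n + k))
      ... | inj₁ p = ⊥-elim (¬e₁ (⇑-≼ p (applyUpTo-mono x (ℕₚ.m≤m+n n k))))
      ... | inj₂ p = ⇑-≼ p (applyUpTo-mono x (ℕₚ.m≤n+m k n))
    unfold (e₁ ⨾ e₂) {x} run with em {e₁ ⇑∞ x}
    ... | yes run₁ = let (w , f , y , t , r , eq) = unfold e₁ run₁ in w , f , y , ⨾₁ t , r , eq
    ... | no ¬run₁ with ¬∀⇒∃¬ ¬run₁
    ... | n , ¬e₁ = join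
      where
      Split : ℕ → ℕ → Set
      Split k l = e₁ ⇓ applyUpTo x l × e₂ ⇑ applyUpTo (λ i → x (l + i)) k

      -- The part executed by e₁ is shorter than n, so infinitely many
      -- prefixes split at the same position.
      splits : ∀ k → ∃ λ l → l < n × Split k l
      splits k with ⨾-⇑⁻ (run (n + k))
      ... | inj₁ p = ⊥-elim (¬e₁ (⇑-≼ p (applyUpTo-mono x (ℕₚ.m≤m+n n k))))
      ... | inj₂ (w , u , eq , p₁ , p₂) = length w , l<n , subst (e₁ ⇓_) w≡ p₁ ,
        ⇑-≼ (subst (e₂ ⇑_) u≡ p₂) (applyUpTo-mono _ k≤u)
        where
        wu⊑x : w ++ u ⊑ inf x
        wu⊑x = subst (_⊑ inf x) eq (applyUpTo-⊑ x (n + k))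
        w≡ : w ≡ applyUpTo x (length w)
        w≡ = ≼-⊑-trans {w = inf x} (≼-++ w) wu⊑x
        l<n : length w < n
        l<n = ℕₚ.≰⇒> λ n≤l → ¬e₁ (⇓⇒⇑ p₁ (subst (applyUpTo x n ≼_) (sym w≡) (applyUpTo-mono x n≤l)))
        u≡ : u ⊑ inf (λ i → x (length w + i))
        u≡ = ⊑-·⁻ w {w = inf _} (⊑-resp-≋ (≋-sym (subst (λ z → z · inf (λ i → x (length w + i)) ≋ inf x) (sym w≡)
               (inf (prepend-applyUpTo x (length w))))) wu⊑x)
        k≤u : k ≤ length u
        k≤u = ℕₚ.≮⇒≥ λ u<k → ℕₚ.<-irrefl
          (trans (sym (length-++ w)) (trans (cong length (sym eq)) (length-applyUpTo x (n + k))))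
          (ℕₚ.+-mono-< l<n u<k)

      Goal : Set
      Goal = ∃₂ λ w f → ∃ λ y → TailCall (e₁ ⨾ e₂) w f × P f ⇑∞ y × (w ++ [ ✓ ]) · inf y ≋ inf x

      join : Goal
      join with pigeonhole always (λ k → fromℕ< (proj₁ (proj₂ (splits k))))
      ... | c , io = at (toℕ c) split
        where
        split : ∀ k → Split k (toℕ c)
        split k with io k
        ... | k′ , k≤k′ , _ , eq =
          let (l , l<n , p₁ , p₂) = splits k′
              l≡ = trans (sym (toℕ-fromℕ< l<n)) (cong toℕ eq)
          in subst (Split k) l≡ (p₁ , ⇑-≼ p₂ (applyUpTo-mono _ k≤k′))
        at : ∀ l → (∀ k → Split k l) → Goal
        at l split with unfold e₂ (proj₂ ∘ split)
        ... | w , f , y , t , r , eq = applyUpTo x l ++ w , f , y , ⨾₂ (proj₁ (split 0)) t , r ,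
          ≋-trans (subst (λ z → z · inf y ≋ applyUpTo x l · ((w ++ [ ✓ ]) · inf y))
              (sym (++-assoc (applyUpTo x l) w [ ✓ ]))
            (·-assoc (applyUpTo x l) (w ++ [ ✓ ]) (inf y)))
          (≋-trans (·-congʳ (applyUpTo x l) eq) (inf (prepend-applyUpTo x l)))

    -- Iterating `unfold` gives the path. Each block contains at least the ✓ of its call, so the
    -- blocks exhaust `x` whatever `θ` leaves of them.
    ↑⇒Diverge : ∀ {e} → (e ↑_) ⊆ Diverge ⊤ e
    ↑⇒Diverge {e} {w} (x , lim , run) with unfold e run
    ... | v , f , y , t , r , eq = v , f , proj₁ rest , t , record
          { proc   = proj₁ ∘ stage
          ; trace  = trace
          ; start  = refl
          ; within = λ _ → ∈⊤
          ; calls  = λ i → proj₁ (proj₂ (proj₂ (proj₂ (step (stage i)))))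
          ; limit  = proj₂ (proj₂ rest)
          } , proj₁ (proj₂ rest)
      where
      Stage : Set
      Stage = ∃₂ λ f y → P f ⇑∞ y
      step : (st : Stage) → _
      step (f , y , r) = unfold (P f) r
      stage : ℕ → Stage
      stage zero    = f , y , r
      stage (suc i) = let (_ , g , z , _ , r′ , _) = step (stage i) in g , z , r′
      trace : ℕ → List Event
      trace i = proj₁ (step (stage i))
      remainder : ∀ i → (trace i ++ [ ✓ ]) · inf (proj₁ (proj₂ (stage (suc i)))) ≋ inf (proj₁ (proj₂ (stage i)))
      remainder i = proj₂ (proj₂ (proj₂ (proj₂ (proj₂ (step (stage i))))))
      d : ℕ → List Event
      d i = trace i ++ [ ✓ ]
      c : ℕ → List Event
      c n = (v ++ [ ✓ ]) ++ concatTo d n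
      c-remainder : ∀ n → concatTo d n · inf (proj₁ (proj₂ (stage n))) ≋ inf y
      c-remainder zero    = ≋-refl
      c-remainder (suc n) = subst (λ z → z · inf (proj₁ (proj₂ (stage (suc n)))) ≋ inf y)
        (sym (concatTo-suc d n))
        (≋-trans (·-assoc (concatTo d n) (d n) _)
        (≋-trans (·-congʳ (concatTo d n) (remainder n)) (c-remainder n)))
      c⊑x : ∀ n → c n ⊑ inf x
      c⊑x n = ⊑-resp-≋ eq (⊑-·⁺ (v ++ [ ✓ ]) {w = inf y} (⊑-resp-≋ (c-remainder n) (⊑-· (concatTo d n))))
      long : ∀ n → n ≤ length (c n)
      long n = ≤-trans (concatTo-long d (λ i → snoc≢[] (trace i)) n)
        (≤-trans (ℕₚ.m≤n+m _ (length (v ++ [ ✓ ]))) (≤-reflexive (sym (length-++ (v ++ [ ✓ ])))))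
      θ-snoc : ∀ u → θ (u ++ [ ✓ ]) ≡ θ u
      θ-snoc u = trans (θ-++ u) (++-identityʳ (θ u))
      rest : ∃ λ w′ → θ v · w′ ≋ w × Limit (concatTo (θ ∘ trace)) w′
      rest = Limit-factor (θ v) (Limit-resp-≗
        (λ n → trans (θ-++ (v ++ [ ✓ ])) (cong₂ _++_ (θ-snoc v) (θ-concatTo (θ-snoc ∘ trace) n)))
        (Limit-θ⁺ c⊑x long lim))

    -- Eliminating one procedure from the graph of tail calls

    module _ {N : Subset m} {f : Fin m} (f∈N : f ∈ˢ N) where

      Loop : Pred (List (Fin s)) 0ℓ
      Loop z = Reach (N - f) (P f) z f

      ⋆-∷ : ∀ {U : Pred (List (Fin s)) 0ℓ} {u w} → U u → (U ⋆) w → (U ⋆) (u ++ w)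
      ⋆-∷ p (ws , ps , refl) = _ ∷ ws , p ∷ ps , refl

      -- Kleene's identity: a path that meets `f` splits into the part up to its first visit, loops
      -- between visits, and the part after the last one, none of which has `f` as an inner vertex.
      Reach-split : ∀ {e w g} → Reach N e w g →
        Reach (N - f) e w g ⊎ ∃₂ λ u z → ∃ λ y →
          Reach (N - f) e u f × (Loop ⋆) z × Reach (N - f) (P f) y g × w ≡ u ++ z ++ y
      Reach-split (stop t g∉N) = inj₁ (stop t (g∉N ∘ p─q⊆p N _))
      Reach-split (go {w = w} {f′} t f′∈N R) with f′ ≟ᶠ f | Reach-split R
      ... | yes refl | inj₁ R′ = inj₂ (θ w , [] , _ , stop t (x∉p-x N f) , ([] , [] , refl) , R′ , refl)
      ... | yes refl | inj₂ (u , z , y , U , Z , Y , refl) =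
        inj₂ (θ w , u ++ z , y , stop t (x∉p-x N f) , ⋆-∷ U Z , Y , cong (θ w ++_) (sym (++-assoc u z y)))
      ... | no f′≢f | inj₁ R′ = inj₁ (go t (x∈p∧x≢y⇒x∈p-y f′∈N f′≢f) R′)
      ... | no f′≢f | inj₂ (u , z , y , U , Z , Y , refl) =
        inj₂ (θ w ++ u , z , y , go t (x∈p∧x≢y⇒x∈p-y f′∈N f′≢f) U , Z , Y , sym (++-assoc (θ w) u (z ++ y)))

      Reach-call : ∀ {w g} → Reach N (call f) w g →
        ∃₂ λ z y → (Loop ⋆) z × Reach (N - f) (P f) y g × z ++ y ≡ w
      Reach-call (stop call f∉N) = ⊥-elim (f∉N f∈N)
      Reach-call (go call _ R) with Reach-split R
      ... | inj₁ R′ = [] , _ , ([] , [] , refl) , R′ , refl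
      ... | inj₂ (u , z , y , U , Z , Y , refl) = u ++ z , y , ⋆-∷ U Z , Y , ++-assoc u z y

      module _ {w} (π : Path N f w) where

        open Path π

        prefix : ℕ → List (Fin s)
        prefix = concatTo (θ ∘ trace)

        -- The search stops at the first visit after `n`, so the vertices in between lie in `N - f`.
        -- `≤‴` recurses by moving its lower end up to the known visit `k`.
        next-visit : ∀ {n k} → suc n ≤‴ k → proc k ≡ f →
          ∃₂ λ k′ z → n < k′ × proc k′ ≡ f × Reach (N - f) (P (proc n)) z f × prefix k′ ≡ prefix n ++ z
        next-visit {n} n<k k≡f with proc (suc n) ≟ᶠ f
        ... | yes eq = suc n , θ (trace n) , ≤-refl , eq ,
          subst (Reach (N - f) (P (proc n)) (θ (trace n))) eq
            (stop (calls n) (subst (_∉ˢ N - f) (sym eq) (x∉p-x N f))) ,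
          concatTo-suc (θ ∘ trace) n
        next-visit ≤‴-refl      k≡f | no ≢f = ⊥-elim (≢f k≡f)
        next-visit {n} (≤‴-step p) k≡f | no ≢f with next-visit p k≡f
        ... | k′ , z , n<k′ , eq , R , eq′ = k′ , θ (trace n) ++ z , <⇒≤ n<k′ , eq ,
          go (calls n) (x∈p∧x≢y⇒x∈p-y (within (suc n)) ≢f) R ,
          trans eq′ (trans (cong (_++ z) (concatTo-suc (θ ∘ trace) n)) (++-assoc (prefix n) _ z))

        visit-after : ∀ {n} → proc n ≡ f → (∃ λ k → n < k × proc k ≡ f) →
          ∃₂ λ k z → n < k × Loop z × proc k ≡ f × prefix k ≡ prefix n ++ z
        visit-after n≡f (k , n<k , k≡f) with next-visit (ℕₚ.≤⇒≤‴ n<k) k≡f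
        ... | k′ , z , n<k′ , eq , R , eq′ =
          k′ , z , n<k′ , subst (λ g → Reach (N - f) (P g) z f) n≡f R , eq , eq′

        recurrent : InfinitelyOften (λ n → proc n ≡ f) → (Loop ^ω) w
        recurrent io = word , (λ i → proj₁ (proj₂ (proj₂ (proj₂ (following (visit i)))))) ,
          Limit-resp-≗ prefix-visit
            (Limit-increasing (proj₁ ∘ visit) (λ i → proj₁ (proj₂ (proj₂ (following (visit i)))))
              (concatTo-mono (θ ∘ trace)) limit)
          where
          following : (v : ∃ λ n → proc n ≡ f) →
            ∃₂ λ k z → proj₁ v < k × Loop z × proc k ≡ f × prefix k ≡ prefix (proj₁ v) ++ z
          following (n , n≡f) = visit-after n≡f (io (suc n))
          visit : ℕ → ∃ λ n → proc n ≡ f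
          visit zero    = 0 , start
          visit (suc i) = let (k , _ , _ , _ , eq , _) = following (visit i) in k , eq
          word : ℕ → List (Fin s)
          word i = proj₁ (proj₂ (following (visit i)))
          prefix-visit : ∀ i → prefix (proj₁ (visit i)) ≡ concatTo word i
          prefix-visit = concatTo-unique word λ i → proj₂ (proj₂ (proj₂ (proj₂ (proj₂ (following (visit i))))))

        -- `l` is fuel: from `l + n` on there is no visit, and passing to a later visit raises `n`
        -- by at least one, which pays for the decrease of `l`.
        last-visit : ∀ l n → proc n ≡ f → (∀ k → l + n ≤ k → proc k ≢ f) →
          ∃₂ λ k z → proc k ≡ f × (Loop ⋆) z × prefix k ≡ prefix n ++ z × ∀ j → k < j → proc j ≢ f
        last-visit zero    n n≡f none = ⊥-elim (none n ≤-refl n≡f)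
        last-visit (suc l) n n≡f none with em {∃ λ k → n < k × proc k ≡ f}
        ... | no ¬later = n , [] , n≡f , ([] , [] , refl) , sym (++-identityʳ _) ,
          λ j n<j j≡f → ¬later (j , n<j , j≡f)
        ... | yes later with visit-after n≡f later
        ... | k , z , n<k , R , k≡f , eq with last-visit l k k≡f
                (λ j l+k≤j → none j (≤-trans
                  (≤-trans (≤-reflexive (sym (ℕₚ.+-suc l n))) (ℕₚ.+-monoʳ-≤ l n<k)) l+k≤j))
        ... | k′ , z′ , k′≡f , Z , eq′ , quiet = k′ , z ++ z′ , k′≡f , ⋆-∷ R Z ,
          trans eq′ (trans (cong (_++ z′) eq) (++-assoc (prefix n) z z′)) , quiet

        transient : ¬ InfinitelyOften (λ n → proc n ≡ f) → (Loop ⋆ ⊙ Diverge (N - f) (P f)) w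
        transient ¬io with ¬io⇒bounded ¬io
        ... | b , none with last-visit b 0 start
                (λ k b≤k → none k (≤-trans (≤-reflexive (sym (ℕₚ.+-identityʳ b))) b≤k))
        ... | k , z , k≡f , Z , eq , quiet
          with Limit-factor z (Limit-resp-≗ {s = λ n → prefix (k + n)}
                 (λ n → trans (concatTo-+ (θ ∘ trace) k n)
                          (cong (_++ concatTo (λ i → θ (trace (k + i))) n) eq))
                 (Limit-cofinal (λ n → k + n , ≼-reflexive refl)
                    (λ n → n , concatTo-mono (θ ∘ trace) (ℕₚ.m≤n+m n k)) limit))
        ... | w′ , eq′ , lim
          with Limit-factor (θ (trace (k + 0))) (Limit-suc refl lim)
        -- The tail call leaving the last visit becomes the leading call of `Diverge`; the path
        -- proper begins one index later, where `f` no longer occurs.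
        ... | w″ , eq″ , lim′ = z , w′ , Z ,
          (trace (k + 0) , proc (suc (k + 0)) , w″ ,
           subst (λ g → TailCall (P g) (trace (k + 0)) (proc (suc (k + 0))))
             (trans (cong proc (ℕₚ.+-identityʳ k)) k≡f) (calls (k + 0)) ,
           record
             { proc   = λ i → proc (k + suc i)
             ; trace  = λ i → trace (k + suc i)
             ; start  = cong proc (ℕₚ.+-suc k 0)
             ; within = λ i → x∈p∧x≢y⇒x∈p-y (within (k + suc i))
                 (quiet (k + suc i) (ℕₚ.m<m+n k (s≤s z≤n)))
             ; calls  = λ i → subst (λ j → TailCall (P (proc (k + suc i))) (trace (k + suc i)) (proc j))
                 (sym (ℕₚ.+-suc k (suc i))) (calls (k + suc i))
             ; limit  = lim′
             } , eq″) , eq′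

      Diverge-call : ∀ {w} → Diverge N (call f) w → (Loop ^ω) w ⊎ (Loop ⋆ ⊙ Diverge (N - f) (P f)) w
      Diverge-call (_ , _ , w′ , call , π , eq)
        with ≋-trans (≋-sym ([]-· w′)) eq | em {InfinitelyOften λ n → Path.proc π n ≡ f}
      ... | eq′ | yes io = let (d , p , lim) = recurrent π io in inj₁ (d , p , Limit-resp-≋ eq′ lim)
      ... | eq′ | no ¬io =
        let (u , v , p , q , r) = transient π ¬io in inj₂ (u , v , p , q , ≋-trans r eq′)

-- Derivations

module Typing (em : ExcludedMiddle 0ℓ) {s m : ℕ} (P : Program s m) (𝔄 : Automaton s)
  (𝔛 : Set) (ι : Fin m ↣ 𝔛) where

  open Semantics P
  open Behaviour P
  open Abstraction 𝔄
  open TypeSystem P 𝔄 𝔛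
  open Classes 𝔄
  open Saturation 𝔄
  open Factorisation em
  open Injection ι using (injective) renaming (to to name-of)
  open Expression using (coeff; const; formal)

  α*-mono : ∀ {U U′ : Pred Q 0ℓ} → U ⊆ U′ → α* U ⊆ α* U′
  α*-mono sub (u , p , q) = u , p , sub q

  α*-cong : ∀ {U U′ : Pred Q 0ℓ} → U ≐ U′ → α* U ≐ α* U′
  α*-cong (f , g) = α*-mono f , α*-mono g

  α*-⋆ : ∀ {𝒜 U : Pred Q 0ℓ} → 𝒜 ⊆ α* U → 𝒜 ⋆ᵃ ⊆ α* (U ⋆)
  α*-⋆ {𝒜} {U} sub (_ , A≈ , ws , ps , refl) with represent ps
    where
    represent : ∀ {ws} → All (γ* 𝒜) ws → ∃ λ us → All U us × concat ws ≈ concat us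
    represent []                     = [] , [] , ≈.refl
    represent ((C , C∈ , C≈w) ∷ ps) with sub C∈ | represent ps
    ... | u , C≈u , u∈ | us , us∈ , eq =
      u ∷ us , u∈ ∷ us∈ , ≈.∙-cong (≈.trans (≈.sym C≈w) C≈u) eq
  ... | us , us∈ , eq = concat us , ≈.trans A≈ eq , us , us∈ , refl

  ⋆⊆⋆ᵃ : ∀ {𝒜 U : Pred Q 0ℓ} → U ⊆ 𝒜 → U ⋆ ⊆ 𝒜 ⋆ᵃ
  ⋆⊆⋆ᵃ sub (ws , ps , refl) =
    concat ws , ≈.refl , ws , All.map (λ {w} p → w , sub p , ≈.refl) ps , refl

  returns : Expr s m → Pred (List (Fin s)) 0ℓ
  returns e = e ↓_

  returns* : Expr s m → 𝓜*
  returns* e = α* (returns e) , α*-resp-≈ (returns e)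

  returns-o : ∀ a → α* (returns (o a)) ≐ α* ｛ [ a ] ｝
  returns-o a = α*-cong ((λ { (_ , refl , ⇓-o) → refl }) , λ { refl → _ , refl , ⇓-o })

  returns-⨾ : ∀ e₁ e₂ → α* (returns (e₁ ⨾ e₂)) ≐ α* (returns e₁) ∙* α* (returns e₂)
  returns-⨾ e₁ e₂ =
    (λ { (_ , C≈ , _ , refl , ⇓-⨾ {w = w} {u} p q) →
      θ w , θ u , (θ w , ≈.refl , w , refl , p) , (θ u , ≈.refl , u , refl , q) ,
      ≈.sym (≈.trans C≈ (≈.reflexive (θ-++ w))) }) ,
    λ { (A , B , (_ , A≈ , w , refl , p) , (_ , B≈ , u , refl , q) , AB≈C) →
      θ (w ++ u) , ≈.trans (≈.sym AB≈C) (≈.trans (≈.∙-cong A≈ B≈) (≈.reflexive (sym (θ-++ w)))) ,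
      _ , refl , ⇓-⨾ p q }

  returns-⁇ : ∀ e₁ e₂ → α* (returns (e₁ ⁇ e₂)) ≐ α* (returns e₁) ∪ α* (returns e₂)
  returns-⁇ e₁ e₂ =
    (λ { (u , p , w , eq , ⇓-⁇₁ q) → inj₁ (u , p , w , eq , q)
       ; (u , p , w , eq , ⇓-⁇₂ q) → inj₂ (u , p , w , eq , q) }) ,
    [ α*-mono (λ (w , eq , q) → w , eq , ⇓-⁇₁ q) , α*-mono (λ (w , eq , q) → w , eq , ⇓-⁇₂ q) ]′

  -- This makes one and the same `𝒰` fit both the binding of `f` and the body of `f` in rule (v).
  returns-call : ∀ f → α* (returns (call f)) ≐ α* (returns (P f))
  returns-call f = α*-cong
    ( (λ { (_ , eq , ⇓-call p) → _ , eq , p }) , λ (w , eq , p) → ✓ ∷ w , eq , ⇓-call p )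

  contexts-∙ : ∀ {e f e′ g} →
    (∀ {u v} → contexts e f u → contexts e′ g v → contexts e g (u ++ v)) →
    α* (contexts e f) ∙* α* (contexts e′ g) ⊆ α* (contexts e g)
  contexts-∙ join (A , B , (u , A≈u , u∈) , (v , B≈v , v∈) , AB≈C) =
    u ++ v , ≈.trans (≈.sym AB≈C) (≈.∙-cong A≈u B≈v) , join u∈ v∈

  _∪*_ : 𝓜* → 𝓜* → 𝓜*
  (𝒰 , r) ∪* (𝒰′ , r′) = 𝒰 ∪ 𝒰′ , λ { C≈ (inj₁ p) → inj₁ (r C≈ p) ; C≈ (inj₂ p) → inj₂ (r′ C≈ p) }

  expression : (𝔛 → 𝓜*) → {𝒱 : Pred (Q × Q) 0ℓ} → Closed 𝒱 → Expression
  expression 𝒰 {𝒱} c = record { coeff = 𝒰 ; const = 𝒱 , Closed⇒𝓜ω c }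

  infixl 6 _⊢-resp-≐ᶠ_

  ≐ᶠ-trans : ∀ {E E′ E″ : Formal} → E ≐ᶠ E′ → E′ ≐ᶠ E″ → E ≐ᶠ E″
  ≐ᶠ-trans (p , q) (p′ , q′) = (λ Y → ≐-trans (p Y) (p′ Y)) , ≐-trans q q′

  -- Used for the final judgement, where the coefficients derived are empty only extensionally while
  -- those of `closed` are `∅` itself.
  _⊢-resp-≐ᶠ_ : ∀ {Δ e 𝒰 V V′} → Δ ⊢ e & 𝒰 , V → formal V′ ≐ᶠ formal V → Δ ⊢ e & 𝒰 , V′
  ⊢o p q ⊢-resp-≐ᶠ eq              = ⊢o p (≐ᶠ-trans eq q)
  ⊢⨾ d d′ p q ⊢-resp-≐ᶠ eq         = ⊢⨾ d d′ p (≐ᶠ-trans eq q)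
  ⊢⁇ d d′ p q ⊢-resp-≐ᶠ eq         = ⊢⁇ d d′ p (≐ᶠ-trans eq q)
  ⊢var b p q ⊢-resp-≐ᶠ eq          = ⊢var b p (≐ᶠ-trans eq q)
  ⊢rec 𝒜 𝒱 fr z d p q ⊢-resp-≐ᶠ eq = ⊢rec 𝒜 𝒱 fr z d p (≐ᶠ-trans eq q)

  -- N is the set of procedures that Δ does not bind.
  record Binds (Δ : Env) (N : Subset m) : Set₁ where
    field
      bound : ∀ {f} → f ∉ˢ N → ∃ λ 𝒰 → proj₁ 𝒰 ≐ α* (returns (call f)) × (f & 𝒰 , name-of f) ∈ Δ
      fresh : ∀ {f} → f ∈ˢ N → ∀ 𝒰 → (f & 𝒰 , name-of f) # Δ

  Binds-cons : ∀ {Δ N f 𝒰} → (b : Binds Δ N) → (f∈N : f ∈ˢ N) → proj₁ 𝒰 ≐ α* (returns (call f)) →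
    Binds (cons (f & 𝒰 , name-of f) Δ (Binds.fresh b f∈N 𝒰)) (N - f)
  Binds-cons {Δ} {N} {f} {𝒰} b f∈N eq = record { bound = bound′ ; fresh = fresh′ }
    where
    open Binds b
    bound′ : ∀ {g} → g ∉ˢ N - f → ∃ λ 𝒰′ → proj₁ 𝒰′ ≐ α* (returns (call g)) ×
      (g & 𝒰′ , name-of g) ∈ cons (f & 𝒰 , name-of f) Δ (fresh f∈N 𝒰)
    bound′ {g} g∉ with g ≟ᶠ f
    ... | yes refl = 𝒰 , eq , here refl
    ... | no g≢f with bound (λ g∈N → g∉ (x∈p∧x≢y⇒x∈p-y g∈N g≢f))
    ... | 𝒰′ , eq′ , b∈ = 𝒰′ , eq′ , there b∈
    fresh′ : ∀ {g} → g ∈ˢ N - f → ∀ 𝒰′ → (g & 𝒰′ , name-of g) # cons (f & 𝒰 , name-of f) Δ (fresh f∈N 𝒰)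
    fresh′ {g} g∈ 𝒰′ =
      (λ eq → x∉p-x N f (subst (_∈ˢ N - f) (injective eq) g∈)) , fresh (p─q⊆p N _ g∈) 𝒰′

  -- The induction hypothesis. `bounded` and `precise` keep the type below the semantics, `covers`
  -- and `diverges` above the paths of tail calls. `bounded` also confines the coefficients to
  -- variables of bound procedures, so none remain when `N` is `⊤`. `𝒰` is a parameter because rule
  -- (v) fixes it beforehand.
  record Typed (Δ : Env) (N : Subset m) (e : Expr s m) (𝒰 : 𝓜*) : Set₁ where
    field
      type       : Expression
      derivation : Δ ⊢ e & 𝒰 , type
      bounded    : ∀ {Y C} → proj₁ (coeff type Y) C →
                   ∃ λ g → Y ≡ name-of g × g ∉ˢ N × α* (contexts e g) C
      precise    : proj₁ (const type) ⊆ αω (e ↑_)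
      covers     : ∀ {w g} → Reach N e w g → proj₁ (coeff type (name-of g)) w
      diverges   : Diverge N e ⊆ 𝔤 (proj₁ (const type))

  open Typed

  typed-o : ∀ {Δ N} a 𝒰 → proj₁ 𝒰 ≐ α* (returns (o a)) → Typed Δ N (o a) 𝒰
  typed-o a 𝒰 eq = record
    { type       = expression (λ _ → ∅ , λ _ ()) Closed-∅
    ; derivation = ⊢o (≐-trans eq (returns-o a)) ((λ _ → ≐-refl) , ≐-refl)
    ; bounded    = λ ()
    ; precise    = λ ()
    ; covers     = λ { (stop () _) ; (go () _ _) }
    ; diverges   = λ { (_ , _ , _ , () , _) }
    }

  typed-⨾ : ∀ {Δ N} e₁ e₂ 𝒰 → proj₁ 𝒰 ≐ α* (returns (e₁ ⨾ e₂)) →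
    Typed Δ N e₁ (returns* e₁) → Typed Δ N e₂ (returns* e₂) → Typed Δ N (e₁ ⨾ e₂) 𝒰
  typed-⨾ {Δ} {N} e₁ e₂ 𝒰 eq t₁ t₂ = record
    { type       = expression
        (λ Y → coeff (type t₁) Y ∪* (α* (returns e₁) ∙* proj₁ (coeff (type t₂) Y) , ∙*-resp-≈))
        (Closed-∪ (𝓜ω-Closed (const (type t₁)))
          (Closed-∙ω {α* (returns e₁)} (𝓜ω-Closed (const (type t₂)))))
    ; derivation = ⊢⨾ (derivation t₁) (derivation t₂) (≐-trans eq (returns-⨾ e₁ e₂))
                     ((λ _ → ≐-refl) , ≐-refl)
    ; bounded    = bounded′
    ; precise    = λ
        { (inj₁ p) → αω-mono {e₁ ↑_} {(e₁ ⨾ e₂) ↑_}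
            (↑-mono ⇑-⨾₁) (precise t₁ p)
        ; (inj₂ (A , C , D , a , p , q)) →
            αω-mono {returns e₁ ⊙ (e₂ ↑_)} {(e₁ ⨾ e₂) ↑_}
              (λ { (_ , _ , (w , refl , r) , r′ , eq) → ↑-resp-≋ eq (↑-prepend w (⇑-⨾₂ r) r′) })
              (∙ω-αω {returns e₁} {e₂ ↑_} (A , C , D , a , precise t₂ p , q)) }
    ; covers     = covers′
    ; diverges   = diverges′
    }
    where
    bounded′ : ∀ {Y C} → proj₁ (coeff (type t₁) Y) C ⊎ (α* (returns e₁) ∙* proj₁ (coeff (type t₂) Y)) C →
      ∃ λ g → Y ≡ name-of g × g ∉ˢ N × α* (contexts (e₁ ⨾ e₂) g) C
    bounded′ (inj₁ p) with bounded t₁ p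
    ... | g , Y≡ , g∉ , q = g , Y≡ , g∉ , α*-mono (contexts-mono ⇑-⨾₁) q
    bounded′ (inj₂ (A , B , (_ , A≈ , w , refl , r) , p , AB≈C)) with bounded t₂ p
    ... | g , Y≡ , g∉ , (_ , B≈ , w′ , refl , ctx) = g , Y≡ , g∉ ,
      θ w ++ θ w′ , ≈.trans (≈.sym AB≈C) (≈.∙-cong A≈ B≈) ,
      w ++ w′ , sym (θ-++ w) , λ {u} q → subst (e₁ ⨾ e₂ ⇑_) (sym (++-assoc w w′ u)) (⇑-⨾₂ r (ctx q))
    right : ∀ {w y g} → e₁ ⇓ w → Reach N e₂ y g →
      (α* (returns e₁) ∙* proj₁ (coeff (type t₂) (name-of g))) (θ w ++ y)
    right {w} {y} r R = θ w , y , (θ w , ≈.refl , w , refl , r) , covers t₂ R , ≈.refl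
    covers′ : ∀ {w g} → Reach N (e₁ ⨾ e₂) w g →
      proj₁ (coeff (type t₁) (name-of g)) w ⊎ (α* (returns e₁) ∙* proj₁ (coeff (type t₂) (name-of g))) w
    covers′ (stop (⨾₁ t) g∉N)    = inj₁ (covers t₁ (stop t g∉N))
    covers′ (stop (⨾₂ {w = w} {u} r t) g∉N) rewrite θ-++ w {u} = inj₂ (right r (stop t g∉N))
    covers′ (go (⨾₁ t) f∈N R)    = inj₁ (covers t₁ (go t f∈N R))
    covers′ (go {u = y} (⨾₂ {w = w} {u} r t) f∈N R)
      rewrite θ-++ w {u} | ++-assoc (θ w) (θ u) y = inj₂ (right r (go t f∈N R))
    diverges′ : Diverge N (e₁ ⨾ e₂) ⊆ 𝔤 _
    diverges′ (v , f , w′ , ⨾₁ t , π , eq) = 𝔤-mono inj₁ (diverges t₁ (v , f , w′ , t , π , eq))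
    diverges′ (_ , f , w′ , ⨾₂ {w = w} {u} r t , π , eq)
      with diverges t₂ (u , f , w′ , t , π , ≋-refl)
    ... | C , D , p , q = θ w ++ C , D ,
      inj₂ (θ w , C , D , (θ w , ≈.refl , w , refl , r) , p , ≈.refl , ≈.refl) ,
      ^ω-resp-≋ (≋-trans (≋-sym (·-assoc (θ w) (θ u) w′))
        (subst (λ z → z · w′ ≋ _) (θ-++ w) eq)) (^ω-∙ (≈.refl {θ w}) q)

  typed-⁇ : ∀ {Δ N} e₁ e₂ 𝒰 → proj₁ 𝒰 ≐ α* (returns (e₁ ⁇ e₂)) →
    Typed Δ N e₁ (returns* e₁) → Typed Δ N e₂ (returns* e₂) → Typed Δ N (e₁ ⁇ e₂) 𝒰
  typed-⁇ {Δ} {N} e₁ e₂ 𝒰 eq t₁ t₂ = record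
    { type       = expression (λ Y → coeff (type t₁) Y ∪* coeff (type t₂) Y)
        (Closed-∪ (𝓜ω-Closed (const (type t₁))) (𝓜ω-Closed (const (type t₂))))
    ; derivation = ⊢⁇ (derivation t₁) (derivation t₂) (≐-trans eq (returns-⁇ e₁ e₂))
                     ((λ _ → ≐-refl) , ≐-refl)
    ; bounded    = λ
        { (inj₁ p) → let (g , Y≡ , g∉ , q) = bounded t₁ p in
            g , Y≡ , g∉ , α*-mono (contexts-mono ⇑-⁇₁) q
        ; (inj₂ p) → let (g , Y≡ , g∉ , q) = bounded t₂ p in
            g , Y≡ , g∉ , α*-mono (contexts-mono ⇑-⁇₂) q }
    ; precise    = λ
        { (inj₁ p) → αω-mono {e₁ ↑_} {(e₁ ⁇ e₂) ↑_}
            (↑-mono ⇑-⁇₁) (precise t₁ p)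
        ; (inj₂ p) → αω-mono {e₂ ↑_} {(e₁ ⁇ e₂) ↑_}
            (↑-mono ⇑-⁇₂) (precise t₂ p) }
    ; covers     = λ
        { (stop (⁇₁ t) g∉N)  → inj₁ (covers t₁ (stop t g∉N))
        ; (stop (⁇₂ t) g∉N)  → inj₂ (covers t₂ (stop t g∉N))
        ; (go (⁇₁ t) f∈N R) → inj₁ (covers t₁ (go t f∈N R))
        ; (go (⁇₂ t) f∈N R) → inj₂ (covers t₂ (go t f∈N R)) }
    ; diverges   = λ
        { (v , f , w′ , ⁇₁ t , r) → 𝔤-mono inj₁ (diverges t₁ (v , f , w′ , t , r))
        ; (v , f , w′ , ⁇₂ t , r) → 𝔤-mono inj₂ (diverges t₂ (v , f , w′ , t , r)) }
    }

  typed-var : ∀ {Δ N f} 𝒰 → proj₁ 𝒰 ≐ α* (returns (call f)) → Binds Δ N → f ∉ˢ N →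
    Typed Δ N (call f) 𝒰
  typed-var {f = f} 𝒰 eq b f∉N with Binds.bound b f∉N
  ... | 𝒰₀ , eq₀ , f∈Δ = record
    { type       = expression
        (λ Y → (λ C → Y ≡ name-of f × C ≈ ε) , λ C≈ (p , q) → p , ≈.trans (≈.sym C≈) q) Closed-∅
    ; derivation = ⊢var f∈Δ (≐-trans eq (≐-sym eq₀)) ((λ _ → ≐-refl) , ≐-refl)
    ; bounded    = λ (Y≡ , C≈) → f , Y≡ , f∉N , [] , C≈ , [] , refl , id
    ; precise    = λ ()
    ; covers     = λ { (stop call _) → refl , ≈.refl ; (go call f∈N _) → ⊥-elim (f∉N f∈N) }
    -- No path inside `N` starts at a bound procedure; divergence through `f` is left to its
    -- variable.
    ; diverges   = λ { (_ , _ , _ , call , π , _) →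
        ⊥-elim (f∉N (subst (_∈ˢ _) (Path.start π) (Path.within π 0))) }
    }

  typed-rec : ∀ {Δ N f} 𝒰 → proj₁ 𝒰 ≐ α* (returns (call f)) → (b : Binds Δ N) (f∈N : f ∈ˢ N) →
    Typed (cons (f & 𝒰 , name-of f) Δ (Binds.fresh b f∈N 𝒰)) (N - f) (P f) 𝒰 →
    Typed Δ N (call f) 𝒰
  typed-rec {Δ} {N} {f} 𝒰 eq b f∈N t = record
    { type       = expression (λ Y → (𝒜 ⋆ᵃ ∙* proj₁ (coeff 𝒱 Y)) , ∙*-resp-≈)
        (Closed-∪ (Closed-∙ω {𝒜 ⋆ᵃ} (𝓜ω-Closed (const (type t)))) (αω-Closed {γ* 𝒜 ^ω}))
    ; derivation = ⊢rec (coeff (type t) X) 𝒱 (Binds.fresh b f∈N 𝒰)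
        ((λ { (≢X , _) → ≢X refl }) , λ ()) (derivation t) unfolded
        ((λ _ → inj₁ , λ { (inj₁ p) → p }) , ≐-refl)
    ; bounded    = bounded′
    ; precise    = λ
        { (inj₁ (A , C , D , a , p , q)) → αω-mono {contexts (call f) f ⊙ (P f ↑_)} {call f ↑_}
            (λ (u , v , c , r , eq) → contexts-⊙ (u , v , c , call-↑ r , eq))
            (∙ω-αω {contexts (call f) f} {P f ↑_} (A , C , D , loops a , precise t p , q))
        ; (inj₂ p) → αω-mono {contexts (P f) f ^ω} {call f ↑_} contexts-^ω (αω-^ω 𝒜⊆ p) }
    ; covers     = covers′
    ; diverges   = diverges′
    }
    where
    X : 𝔛
    X = name-of f
    𝒜 : Pred Q 0ℓ
    𝒜 = proj₁ (coeff (type t) X)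
    𝒱 : Expression
    𝒱 = record
      -- The guard empties the coefficient at `X`, as rule (v) demands. Equality on `𝔛` is not given
      -- as decidable; `unfolded` decides it by excluded middle to recover the full type.
      { coeff = λ Y → (λ C → Y ≢ X × proj₁ (coeff (type t) Y) C) ,
                      λ C≈ (Y≢X , p) → Y≢X , proj₂ (coeff (type t) Y) C≈ p
      ; const = const (type t)
      }
    unfolded : formal (type t) ≐ᶠ 𝒜 ∙ᶠ var X ∪ᶠ formal 𝒱
    unfolded = (λ Y → split Y , merge Y) , inj₂ , λ { (inj₁ (_ , _ , _ , _ , () , _)) ; (inj₂ p) → p }
      where
      split : ∀ Y → proj₁ (coeff (type t) Y) ⊆ 𝒜 ∙* (λ C → Y ≡ X × C ≈ ε) ∪ proj₁ (coeff 𝒱 Y)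
      split Y {C} p with em {Y ≡ X}
      ... | yes refl = inj₁ (C , [] , p , (refl , ≈.refl) , ≈.reflexive (++-identityʳ C))
      ... | no Y≢X   = inj₂ (Y≢X , p)
      merge : ∀ Y → 𝒜 ∙* (λ C → Y ≡ X × C ≈ ε) ∪ proj₁ (coeff 𝒱 Y) ⊆ proj₁ (coeff (type t) Y)
      merge Y (inj₁ (A , E , a , (refl , E≈ε) , AE≈C)) = proj₂ (coeff (type t) X)
        (≈.trans (≈.trans (≈.reflexive (sym (++-identityʳ A))) (≈.∙-cong (≈.refl {A}) (≈.sym E≈ε))) AE≈C) a
      merge Y (inj₂ (_ , p)) = p
    𝒜⊆ : 𝒜 ⊆ α* (contexts (P f) f)
    𝒜⊆ p with bounded t p
    ... | g , X≡ , _ , q with injective X≡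
    ... | refl = q
    loops : 𝒜 ⋆ᵃ ⊆ α* (contexts (call f) f)
    loops a = α*-mono contexts-⋆ (α*-⋆ 𝒜⊆ a)
    bounded′ : ∀ {Y C} → (𝒜 ⋆ᵃ ∙* proj₁ (coeff 𝒱 Y)) C →
      ∃ λ g → Y ≡ name-of g × g ∉ˢ N × α* (contexts (call f) g) C
    bounded′ (A , B , a , (Y≢X , p) , AB≈C) with bounded t p
    ... | g , refl , g∉ , q = g , refl , (λ g∈N → g∉ (x∈p∧x≢y⇒x∈p-y g∈N λ { refl → Y≢X refl })) ,
      -- The loops lead back to a call of `f`; its last unfolding contributes the ✓ between the two
      -- words.
      contexts-∙ (λ { (w , refl , ctx) (w′ , refl , ctx′) → w ++ ✓ ∷ w′ , sym (θ-++ w) ,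
        λ {u} r → subst (call f ⇑_) (sym (++-assoc w (✓ ∷ w′) u)) (ctx (⇑-call (ctx′ r))) })
        (A , B , loops a , q , AB≈C)
    Reach-∉ : ∀ {e w g} → Reach N e w g → g ∉ˢ N
    Reach-∉ (stop _ g∉N) = g∉N
    Reach-∉ (go _ _ R)   = Reach-∉ R
    covers′ : ∀ {w g} → Reach N (call f) w g → (𝒜 ⋆ᵃ ∙* proj₁ (coeff 𝒱 (name-of g))) w
    covers′ R with Reach-call em f∈N R
    ... | z , y , Z , Y , refl = z , y , ⋆⊆⋆ᵃ (covers t) Z ,
      -- The target of the path lies outside `N` and `f` inside, so the guard holds by injectivity
      -- of the names.
      ((λ eq → Reach-∉ R (subst (_∈ˢ N) (sym (injective eq)) f∈N)) , covers t Y) , ≈.refl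
    diverges′ : Diverge N (call f) ⊆ 𝔤 (𝒜 ⋆ᵃ ∙ω proj₁ (const (type t)) ∪ 𝒜 ωᵃ)
    diverges′ p with Diverge-call em f∈N p
    ... | inj₁ (d , d∈ , lim) = 𝔤-mono inj₂ (^ω⊆𝔤-αω {γ* 𝒜} (d , (λ i → d i , covers t (d∈ i) , ≈.refl) , lim))
    ... | inj₂ (z , w′ , Z , q , eq) with diverges t q
    ... | C , D , r , w′∈ = z ++ C , D , inj₁ (z , C , D , ⋆⊆⋆ᵃ (covers t) Z , r , ≈.refl , ≈.refl) ,
      ^ω-resp-≋ eq (^ω-∙ (≈.refl {z}) w′∈)

  -- Lexicographic recursion on `n` and the expression: entering a body may enlarge the expression
  -- but removes a procedure from `N`. Every occurrence of an unbound call gets a derivation of its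
  -- own.
  typed : ∀ n {Δ N} → ∣ N ∣ ≤ n → Binds Δ N → ∀ e 𝒰 → proj₁ 𝒰 ≐ α* (returns e) → Typed Δ N e 𝒰
  typed n N≤n b (o a)     𝒰 eq = typed-o a 𝒰 eq
  typed n N≤n b (e₁ ⨾ e₂) 𝒰 eq = typed-⨾ e₁ e₂ 𝒰 eq
    (typed n N≤n b e₁ (returns* e₁) ≐-refl) (typed n N≤n b e₂ (returns* e₂) ≐-refl)
  typed n N≤n b (e₁ ⁇ e₂) 𝒰 eq = typed-⁇ e₁ e₂ 𝒰 eq
    (typed n N≤n b e₁ (returns* e₁) ≐-refl) (typed n N≤n b e₂ (returns* e₂) ≐-refl)
  typed n {N = N} N≤n b (call f) 𝒰 eq with f ∈? N
  ... | no f∉N  = typed-var 𝒰 eq b f∉N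
  typed zero    N≤n b (call f) 𝒰 eq | yes f∈N = ⊥-elim (ℕₚ.<⇒≱ (x∈p⇒∣p-x∣<∣p∣ f∈N) (≤-trans N≤n z≤n))
  typed (suc n) N≤n b (call f) 𝒰 eq | yes f∈N = typed-rec 𝒰 eq b f∈N
    (typed n (ℕₚ.≤-pred (≤-trans (x∈p⇒∣p-x∣<∣p∣ f∈N) N≤n)) (Binds-cons b f∈N eq) (P f) 𝒰
      (≐-trans eq (returns-call f)))

  module _ (f : Fin m) where

    private
      t : Typed [] ⊤ (call f) (returns* (call f))
      t = typed m (∣p∣≤n ⊤) (record { bound = λ f∉⊤ → ⊥-elim (f∉⊤ ∈⊤) ; fresh = λ _ _ → _ })
            (call f) (returns* (call f)) ≐-refl

    derivable : [] ⊢ call f & returns* (call f) , closed (const (type t))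
    derivable = derivation t ⊢-resp-≐ᶠ
      ((λ Y → (λ ()) , λ p → ⊥-elim (proj₁ (proj₂ (proj₂ (bounded t p))) ∈⊤)) , ≐-refl)

    exact : T f ⊆ L ⇔ finitary (γ* (proj₁ (returns* (call f)))) ∪ γω (proj₁ (const (type t))) ⊆ L
    exact = mk⇔ to from
      where
      to : T f ⊆ L → finitary (γ* (α* (returns (call f)))) ∪ γω (proj₁ (const (type t))) ⊆ L
      to T⊆L {fin w} (inj₁ (C , (u , C≈u , u∈) , C≈w)) =
        saturated-fin (≈.trans (≈.sym C≈u) C≈w) (T⊆L (inj₁ u∈))
      to T⊆L (inj₂ p) = γω-αω-⊆L (T⊆L ∘ inj₂) (𝔤-mono (precise t) p)
      from : finitary (γ* (α* (returns (call f)))) ∪ γω (proj₁ (const (type t))) ⊆ L → T f ⊆ L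
      from ⊆L {fin w} (inj₁ p) = ⊆L (inj₁ (w , (w , ≈.refl , p) , ≈.refl))
      from ⊆L (inj₂ p)         = ⊆L (inj₂ (diverges t (↑⇒Diverge em p)))

theorem14 :
    ExcludedMiddle 0ℓ →
    {s m : ℕ} (P : Program s m) (𝔄 : Automaton s) (𝔛 : Set) → Fin m ↣ 𝔛 →
    let open Semantics P
        open Abstraction 𝔄
        open TypeSystem P 𝔄 𝔛
    in
    (f : Fin m) →
    Σ 𝓜* λ 𝒰 → Σ 𝓜ω λ 𝒱 →
      ([] ⊢ call f & 𝒰 , closed 𝒱) ×
      (T f ⊆ L ⇔ finitary (γ* (proj₁ 𝒰)) ∪ γω (proj₁ 𝒱) ⊆ L)
theorem14 em P 𝔄 𝔛 ι f = _ , _ , derivable f , exact f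
  where open Typing em P 𝔄 𝔛 ι
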